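{- For every $A\in 2^\omega$ there is a sequence in $2^\omega$ which is both higher $A$-left-c.e. and higher $A$-ML-random. Such a sequence can be found uniformly in $A$: there is a single $\Pi^1_1$ set $W\subseteq 2^{<\omega}\times 2^{<\omega}$ such that for every $A\in 2^\omega$ there is a higher $A$-ML-random sequence $X\in 2^\omega$ with $W^A=\{\sigma\in 2^{<\omega}:\sigma<X\}$.
   Context: For $A\in 2^\omega$ and $W\subseteq 2^{<\omega}\times 2^{<\omega}$ let $W^A=\{\sigma : (\exists \tau\prec A)\ (\tau,\sigma)\in W\}$, where $\tau\prec A$ means that $\tau$ is a finite initial segment of $A$. A set of strings is higher $A$-c.e. if it equals $W^A$ for some $\Pi^1_1$ (lightface, no oracle) set $W\subseteq 2^{<\omega}\times 2^{<\omega}$. For $\sigma\in 2^{<\omega}$ and $X\in 2^\omega$, $\sigma<X$ means that $\sigma$ is lexicographically to the left of $X$: for some $n<|\sigma|$, $\sigma$ and $X$ agree below $n$ and $\sigma(n)<X(n)$. $X$ is higher $A$-left-c.e. if $\{\sigma\in 2^{<\omega}:\sigma<X\}$ is higher $A$-c.e. For $V\subseteq 2^{<\omega}$ let $[V]^\prec=\{X\in 2^\omega : (\exists\sigma\prec X)\ \sigma\in V\}$. A sequence $\langle \mathcal{U}_n\rangle_{n<\omega}$ of subsets of $2^\omega$ is uniformly higher $A$-c.e. open if there is a single $\Pi^1_1$ set $U\subseteq\omega\times 2^{<\omega}\times 2^{<\omega}$ with $\mathcal{U}_n=[U_n^A]^\prec$ for all $n$, where $U_n=\{(\tau,\sigma):(n,\tau,\sigma)\in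 U\}$. $\lambda$ is the fair-coin measure on $2^\omega$. A higher $A$-ML-test is a uniformly higher $A$-c.e. open sequence $\langle\mathcal{U}_n\rangle$ with $\lambda(\mathcal{U}_n)\leq 2^{ -n}$ for all $n$. $X\in 2^\omega$ is higher $A$-ML-random if $X\notin\bigcap_n\mathcal{U}_n$ for every higher $A$-ML-test $\langle\mathcal{U}_n\rangle$. -}

module Defs where

open import Data.Bool.Base as Bool using (Bool; true; false)
open import Data.Fin.Base as Fin using (Fin; toℕ)
open import Data.Integer.Base using (+_)
open import Data.List.Base as List using (List; []; _∷_; length; applyUpTo)
open import Data.Nat.Base as ℕ using (ℕ; zero; suc)
open import Data.Nat.Properties using (m^n≢0)
open import Data.Product.Base using (∃; ∃-syntax; _×_; _,_)
open import Data.Rational.Base as ℚ using (ℚ; 0ℚ; _/_)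
open import Data.Sum.Base using (_⊎_)
open import Data.Vec.Base as Vec using (Vec; []; _∷_)
open import Function.Bundles using (_⇔_)
open import Level using (0ℓ) renaming (suc to lsuc)
open import Relation.Binary.PropositionalEquality.Core using (_≡_)
open import Relation.Nullary.Negation.Core using (¬_)
open import Relation.Unary using (Pred; _∈_; _∉_; _≐_; ⋂)

Cantor : Set
Cantor = ℕ → Bool

Str : Set
Str = List Bool

infix 4 _≺_ _◁_

_≺_ : Str → Cantor → Set
τ ≺ A = ∃[ n ] τ ≡ applyUpTo A n

-- σ ◁ X : σ is lexicographically to the left of X.  (Bool._<_ is false < true.)
_◁_ : Str → Cantor → Set
σ ◁ X = ∃[ n ] (∀ (m : Fin (length σ)) → m Fin.< n → List.lookup σ m ≡ X (toℕ m))
             × List.lookup σ n Bool.< X (toℕ n)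

-- Arithmetical formulas in the language of second-order arithmetic, with k free
-- number variables (de Bruijn: index zero is the innermost bound one) and
-- exactly one free set variable Z.

data Term (k : ℕ) : Set where
  var       : Fin k → Term k
  𝟘 𝟙       : Term k
  _⊕_ _⊗_   : Term k → Term k → Term k

data Formula (k : ℕ) : Set where
  _≐ᶠ_ _<ᶠ_      : Term k → Term k → Formula k
  _∈Z            : Term k → Formula k
  ¬ᶠ_            : Formula k → Formula k
  _∧ᶠ_ _∨ᶠ_ _⇒ᶠ_ : Formula k → Formula k → Formula k
  ∀ᶠ_ ∃ᶠ_        : Formula (suc k) → Formula k

⟦_⟧ : ∀ {k} → Term k → Vec ℕ k → ℕ
⟦ var i ⟧ v = Vec.lookup v i
⟦ 𝟘 ⟧     v = 0
⟦ 𝟙 ⟧     v = 1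
⟦ s ⊕ t ⟧ v = ⟦ s ⟧ v ℕ.+ ⟦ t ⟧ v
⟦ s ⊗ t ⟧ v = ⟦ s ⟧ v ℕ.* ⟦ t ⟧ v

Sat : ∀ {k} → Cantor → Vec ℕ k → Formula k → Set
Sat Z v (s ≐ᶠ t) = ⟦ s ⟧ v ≡ ⟦ t ⟧ v
Sat Z v (s <ᶠ t) = ⟦ s ⟧ v ℕ.< ⟦ t ⟧ v
Sat Z v (t ∈Z)   = Z (⟦ t ⟧ v) ≡ true
Sat Z v (¬ᶠ φ)   = ¬ Sat Z v φ
Sat Z v (φ ∧ᶠ ψ) = Sat Z v φ × Sat Z v ψ
Sat Z v (φ ∨ᶠ ψ) = Sat Z v φ ⊎ Sat Z v ψ
Sat Z v (φ ⇒ᶠ ψ) = Sat Z v φ → Sat Z v ψ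
Sat Z v (∀ᶠ φ)   = ∀ n → Sat Z (n ∷ v) φ
Sat Z v (∃ᶠ φ)   = ∃[ n ] Sat Z (n ∷ v) φ

-- Bijective base-two numeral of a string (digits 1 and 2, least significant
-- first), a computable bijection from strings to ℕ.
⌜_⌝ : Str → ℕ
⌜ [] ⌝        = 0
⌜ false ∷ σ ⌝ = 1 ℕ.+ 2 ℕ.* ⌜ σ ⌝
⌜ true  ∷ σ ⌝ = 2 ℕ.+ 2 ℕ.* ⌜ σ ⌝

code₂ : Str × Str → Vec ℕ 2
code₂ (τ , σ) = ⌜ τ ⌝ ∷ ⌜ σ ⌝ ∷ []

code₃ : ℕ × Str × Str → Vec ℕ 3
code₃ (n , τ , σ) = n ∷ ⌜ τ ⌝ ∷ ⌜ σ ⌝ ∷ []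

-- Lightface Π¹₁: defined by a formula ∀Z φ with φ arithmetical and without
-- parameters.
Π¹₁ : ∀ {k} {D : Set} → (D → Vec ℕ k) → Pred D 0ℓ → Set
Π¹₁ {k} code S = ∃[ φ ] ∀ x → x ∈ S ⇔ (∀ Z → Sat {k} Z (code x) φ)

infix 30 _^[_]

_^[_] : Pred (Str × Str) 0ℓ → Cantor → Pred Str 0ℓ
(W ^[ A ]) σ = ∃[ τ ] τ ≺ A × (τ , σ) ∈ W

HigherCE : Cantor → Pred Str 0ℓ → Set (lsuc 0ℓ)
HigherCE A S = ∃[ W ] Π¹₁ code₂ W × S ≐ W ^[ A ]

LeftCut : Cantor → Pred Str 0ℓ
LeftCut X σ = σ ◁ X

HigherLeftCE : Cantor → Cantor → Set (lsuc 0ℓ)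
HigherLeftCE A X = HigherCE A (LeftCut X)

[_]≺ : Pred Str 0ℓ → Pred Cantor 0ℓ
[ V ]≺ X = ∃[ σ ] σ ≺ X × σ ∈ V

UniformlyHigherCEOpen : Cantor → (ℕ → Pred Cantor 0ℓ) → Set (lsuc 0ℓ)
UniformlyHigherCEOpen A 𝒰 =
  ∃[ U ] Π¹₁ code₃ U × (∀ n → 𝒰 n ≐ [ (λ (τ , σ) → U (n , τ , σ)) ^[ A ] ]≺)

2^-_ : ℕ → ℚ
2^- n = _/_ (+ 1) (2 ℕ.^ n) {{m^n≢0 2 n}}

weight : (ℕ → Str) → ℕ → ℚ
weight c zero    = 0ℚ
weight c (suc k) = weight c k ℚ.+ 2^- (length (c k))

-- λ(𝒰) ≤ q for the fair-coin measure λ, as the outer measure generated by the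
-- cylinders (it agrees with λ on measurable sets): for every ε > 0 some
-- sequence of cylinders covers 𝒰 and has total measure at most q + ε.  Finite
-- covers need no separate case, as they can be padded with arbitrarily small
-- cylinders.
Measure≤ : Pred Cantor 0ℓ → ℚ → Set
Measure≤ 𝒰 q = ∀ ε → 0ℚ ℚ.< ε →
  ∃[ c ] (∀ X → X ∈ 𝒰 → ∃[ i ] c i ≺ X) × (∀ k → weight c k ℚ.≤ q ℚ.+ ε)

HigherMLTest : Cantor → (ℕ → Pred Cantor 0ℓ) → Set (lsuc 0ℓ)
HigherMLTest A 𝒰 = UniformlyHigherCEOpen A 𝒰 × (∀ n → Measure≤ (𝒰 n) (2^- n))

HigherMLRandom : Cantor → Cantor → Set (lsuc 0ℓ)
HigherMLRandom A X = ∀ 𝒰 → HigherMLTest A 𝒰 → X ∉ ⋂ ℕ 𝒰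

{-# OPTIONS --safe #-}
module Submission where

-- For a higher A-c.e. open set U_e given by the level e + 2 of the candidate test with index e, let
--   h(x) = Σ_e min(2^-(e+1), 2 λ(U_e ∩ [0,x]))   and   α = sup {x dyadic : x < h(x)}.
-- The function h is non-decreasing. If (U_e) belongs to a genuine A-test then λ(U_e) ≤ 2^-(e+2), so
-- the minimum is its second argument; if moreover α ∈ U_e, then moving x to the right of α inside U_e
-- by d raises h by 2d, so that x < h(x) beyond α, a contradiction. Hence α is random. Candidates
-- that are not tests do no harm, because each of them contributes at most 2^-(e+1). Since h grows
-- with the sets U_e, the condition x < h(x) is positive in the axioms enumerated so far; neither
-- stages nor any trimming of the enumerations are needed, and the left cut of α is uniformly
-- higher A-c.e.
--
-- The Π¹₁ definition is of the form "every set Z closed under certain arithmetical clauses contains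
-- the goal". Truth of arithmetical formulas is handled in the same way, which yields a Π¹₁ formula
-- that is universal for Π¹₁ sets.

open import Defs
open import Axiom.ExcludedMiddle using (ExcludedMiddle)
open import Data.Bool.Base as Bool using (Bool; true; false; if_then_else_)
open import Data.Bool.Properties using () renaming (_≟_ to _≟ᵇ_)
open import Data.Empty using (⊥)
open import Data.Fin using (#_)
open import Data.Fin.Base using (Fin; zero; suc; _↑ˡ_; _↑ʳ_)
import Data.Integer.Base as ℤ
open import Data.List.Base using (List; []; _∷_; length; _++_; _∷ʳ_; applyUpTo; replicate)
open import Data.List.Properties
  using (length-++; applyUpTo-∷ʳ; ++-assoc; ++-identityʳ; length-applyUpTo; length-replicate; ∷-injectiveˡ; ∷-injectiveʳ)
open import Data.Nat.Base as ℕ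
  using (ℕ; zero; suc; _+_; _*_; _^_; _⊔_; _⊓_; _≤_; _<_; z≤n; s≤s; s≤s⁻¹; NonZero; >-nonZero; >-nonZero⁻¹)
open import Data.Nat.Properties
open import Data.Nat.Tactic.RingSolver using (solve-∀)
open import Data.Product.Base using (∃-syntax; _×_; _,_; proj₁; proj₂)
open import Data.Rational.Base as ℚ using (ℚ; 0ℚ; _/_)
import Data.Rational.Properties as ℚ
import Data.Rational.Unnormalised.Base as ℚᵘ
import Data.Rational.Unnormalised.Properties as ℚᵘ
open import Data.Sum.Base as Sum using (_⊎_; inj₁; inj₂; [_,_]′)
open import Data.Vec.Base as Vec using (Vec; []; _∷_)
open import Data.Vec.Properties using (lookup-++ˡ; lookup-++ʳ)
open import Function.Base using (_∘_; id)
open import Function.Bundles using (_⇔_; mk⇔; Equivalence)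
open import Level using (0ℓ)
open import Relation.Binary.Definitions using (tri<; tri≈; tri>)
open import Relation.Binary.PropositionalEquality
open import Relation.Nullary.Decidable.Core using (Dec; yes; no; does)
open import Relation.Nullary.Negation using (¬_; contradiction)
open import Relation.Unary using (Pred; _≐_)

-- Coding

-- Strictly larger than both arguments, so that numbers can be decoded by recursion.
pair : ℕ → ℕ → ℕ
pair x y = ((y + x) * (y + x) + x) + 1

-- Put s = y + x. As x ≤ s, the number s² + x lies in [s², (s + 1)²), so different sums occupy
-- disjoint blocks.
pair-mono : ∀ x y x′ y′ → y + x < y′ + x′ → pair x y < pair x′ y′
pair-mono x y x′ y′ lt = +-monoˡ-< 1 (begin-strict
  (y + x) * (y + x) + x             ≤⟨ +-monoʳ-≤ ((y + x) * (y + x)) (m≤n+m x y) ⟩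
  (y + x) * (y + x) + (y + x)       ≡⟨ +-comm ((y + x) * (y + x)) (y + x) ⟩
  suc (y + x) * (y + x)             ≤⟨ *-monoˡ-≤ (y + x) lt ⟩
  (y′ + x′) * (y + x)               <⟨ *-monoʳ-< (y′ + x′) {{>-nonZero (≤-trans (s≤s z≤n) lt)}} lt ⟩
  (y′ + x′) * (y′ + x′)             ≤⟨ m≤m+n _ x′ ⟩
  (y′ + x′) * (y′ + x′) + x′        ∎)
  where open ≤-Reasoning

pair-injective : ∀ x y x′ y′ → pair x y ≡ pair x′ y′ → x ≡ x′ × y ≡ y′
pair-injective x y x′ y′ eq with <-cmp (y + x) (y′ + x′)
... | tri< lt _ _ = contradiction eq (<⇒≢ (pair-mono x y x′ y′ lt))
... | tri> _ _ gt = contradiction (sym eq) (<⇒≢ (pair-mono x′ y′ x y gt))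
... | tri≈ _ s≡s′ _ = x≡x′ , +-cancelʳ-≡ x y y′ (trans s≡s′ (cong (y′ +_) (sym x≡x′)))
  where
  x≡x′ : x ≡ x′
  x≡x′ = +-cancelˡ-≡ ((y + x) * (y + x)) x x′
    (trans (+-cancelʳ-≡ 1 _ _ eq) (cong (λ s → s * s + x′) (sym s≡s′)))

pair-suc : ∀ x y → pair x y ≡ suc ((y + x) * (y + x) + x)
pair-suc x y = +-comm _ 1

n≤n*n : ∀ n → n ≤ n * n
n≤n*n zero    = z≤n
n≤n*n (suc n) = m≤m+n (suc n) (n * suc n)

fst<pair : ∀ x y → x < pair x y
fst<pair x y rewrite pair-suc x y = s≤s (m≤n+m x _)

snd<pair : ∀ x y → y < pair x y
snd<pair x y rewrite pair-suc x y =
  s≤s (≤-trans (≤-trans (m≤m+n y x) (n≤n*n (y + x))) (m≤m+n _ x))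

enc : List ℕ → ℕ
enc []       = 0
enc (x ∷ xs) = pair x (enc xs)

enc-injective : ∀ xs ys → enc xs ≡ enc ys → xs ≡ ys
enc-injective []       []       _  = refl
enc-injective []       (y ∷ ys) eq = contradiction (trans eq (pair-suc y (enc ys))) 0≢1+n
enc-injective (x ∷ xs) []       eq = contradiction (trans (sym eq) (pair-suc x (enc xs))) 0≢1+n
enc-injective (x ∷ xs) (y ∷ ys) eq with pair-injective x (enc xs) y (enc ys) eq
... | x≡y , p = cong₂ _∷_ x≡y (enc-injective xs ys p)

-- A truth predicate for arithmetical formulas

x0 : ∀ {k} → Term (1 + k)
x0 = var (# 0)

x1 : ∀ {k} → Term (2 + k)
x1 = var (# 1)

x2 : ∀ {k} → Term (3 + k)
x2 = var (# 2)

x3 : ∀ {k} → Term (4 + k)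
x3 = var (# 3)

x4 : ∀ {k} → Term (5 + k)
x4 = var (# 4)

x5 : ∀ {k} → Term (6 + k)
x5 = var (# 5)

x6 : ∀ {k} → Term (7 + k)
x6 = var (# 6)

x7 : ∀ {k} → Term (8 + k)
x7 = var (# 7)

x8 : ∀ {k} → Term (9 + k)
x8 = var (# 8)

x9 : ∀ {k} → Term (10 + k)
x9 = var (# 9)

x10 : ∀ {k} → Term (11 + k)
x10 = var (# 10)

num : ∀ {k} → ℕ → Term k
num zero    = 𝟘
num (suc n) = 𝟙 ⊕ num n

-- Mirrors `pair` operation by operation, so that its evaluation is `pair` of the values by
-- computation alone and clauses can be applied without rewriting.
pairᵗ : ∀ {k} → Term k → Term k → Term k
pairᵗ s t = (((t ⊕ s) ⊗ (t ⊕ s)) ⊕ s) ⊕ 𝟙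

encᵗ : ∀ {k} → List (Term k) → Term k
encᵗ []       = 𝟘
encᵗ (t ∷ ts) = pairᵗ t (encᵗ ts)

node : ℕ → ℕ → ℕ → ℕ
node i a b = pair i (pair a b)

nodeᵗ : ∀ {k} → ℕ → Term k → Term k → Term k
nodeᵗ i a b = pairᵗ (num i) (pairᵗ a b)

-- Environments have the shape of syntax nodes, so that the one decoder `decode` serves formulas and
-- environments alike.
cons : ℕ → ℕ → ℕ
cons n v = node n 0 v

consᵗ : ∀ {k} → Term k → Term k → Term k
consᵗ n v = pairᵗ n (pairᵗ 𝟘 v)

infix 1 _⇔ᶠ_
infixr 2 _∧_
infixr 1 _⇒_

_∧_ _⇒_ _⇔ᶠ_ : ∀ {k} → Formula k → Formula k → Formula k
_∧_ = _∧ᶠ_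
_⇒_ = _⇒ᶠ_
φ ⇔ᶠ ψ = (φ ⇒ᶠ ψ) ∧ᶠ (ψ ⇒ᶠ φ)

∀² : ∀ {k} → Formula (2 + k) → Formula k
∀² φ = ∀ᶠ ∀ᶠ φ

∀³ : ∀ {k} → Formula (3 + k) → Formula k
∀³ φ = ∀ᶠ ∀ᶠ ∀ᶠ φ

∀⁴ : ∀ {k} → Formula (4 + k) → Formula k
∀⁴ φ = ∀ᶠ ∀ᶠ ∀ᶠ ∀ᶠ φ

∀⁵ : ∀ {k} → Formula (5 + k) → Formula k
∀⁵ φ = ∀ᶠ ∀ᶠ ∀ᶠ ∀ᶠ ∀ᶠ φ

∀⁸ : ∀ {k} → Formula (8 + k) → Formula k
∀⁸ φ = ∀⁴ (∀⁴ φ)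

∀⁹ : ∀ {k} → Formula (9 + k) → Formula k
∀⁹ φ = ∀⁵ (∀⁴ φ)

-- De Bruijn indices are unary trees with tags 0 and 1. A variable is coded by its bare index, so
-- the remaining term tags start at 2.
⌜_⌝ᵛ : ∀ {k} → Fin k → ℕ
⌜ zero ⌝ᵛ  = node 0 0 0
⌜ suc i ⌝ᵛ = node 1 ⌜ i ⌝ᵛ 0

⌜_⌝ᵗ : ∀ {k} → Term k → ℕ
⌜ var i ⌝ᵗ = ⌜ i ⌝ᵛ
⌜ 𝟘 ⌝ᵗ     = node 2 0 0
⌜ 𝟙 ⌝ᵗ     = node 3 0 0
⌜ s ⊕ t ⌝ᵗ = node 4 ⌜ s ⌝ᵗ ⌜ t ⌝ᵗ
⌜ s ⊗ t ⌝ᵗ = node 5 ⌜ s ⌝ᵗ ⌜ t ⌝ᵗ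

⌜_⌝ᶠ : ∀ {k} → Formula k → ℕ
⌜ s ≐ᶠ t ⌝ᶠ = node 0 ⌜ s ⌝ᵗ ⌜ t ⌝ᵗ
⌜ s <ᶠ t ⌝ᶠ = node 1 ⌜ s ⌝ᵗ ⌜ t ⌝ᵗ
⌜ t ∈Z ⌝ᶠ   = node 2 ⌜ t ⌝ᵗ 0
⌜ ¬ᶠ φ ⌝ᶠ   = node 3 ⌜ φ ⌝ᶠ 0
⌜ φ ∧ᶠ ψ ⌝ᶠ = node 4 ⌜ φ ⌝ᶠ ⌜ ψ ⌝ᶠ
⌜ φ ∨ᶠ ψ ⌝ᶠ = node 5 ⌜ φ ⌝ᶠ ⌜ ψ ⌝ᶠ
⌜ φ ⇒ᶠ ψ ⌝ᶠ = node 6 ⌜ φ ⌝ᶠ ⌜ ψ ⌝ᶠ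
⌜ ∀ᶠ φ ⌝ᶠ   = node 7 ⌜ φ ⌝ᶠ 0
⌜ ∃ᶠ φ ⌝ᶠ   = node 8 ⌜ φ ⌝ᶠ 0

⌜_⌝ᵉ : ∀ {k} → Vec ℕ k → ℕ
⌜ [] ⌝ᵉ    = 0
⌜ n ∷ v ⌝ᵉ = cons n ⌜ v ⌝ᵉ

Valᶠ : ∀ {k} → Term k → Term k → Term k → Formula k
Valᶠ t v n = encᵗ (num 0 ∷ t ∷ v ∷ n ∷ []) ∈Z

Trueᶠ : ∀ {k} → Term k → Term k → Formula k
Trueᶠ a v = encᵗ (num 1 ∷ a ∷ v ∷ []) ∈Z

Setᶠ : ∀ {k} → Term k → Formula k
Setᶠ n = encᵗ (num 2 ∷ n ∷ []) ∈Z

-- Columns 0, 1 and 2 of Z hold the values of terms, a truth predicate and a set M; the clauses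
-- say that the predicate is truth in (ℕ, M).
tarski : ∀ {k} → Formula k
tarski =
    ∀² (Valᶠ (nodeᵗ 0 𝟘 𝟘) (consᵗ x1 x0) x1)
  ∧ ∀⁴ (Valᶠ x3 x1 x0 ⇒ Valᶠ (nodeᵗ 1 x3 𝟘) (consᵗ x2 x1) x0)
  ∧ ∀ᶠ (Valᶠ (nodeᵗ 2 𝟘 𝟘) x0 𝟘)
  ∧ ∀ᶠ (Valᶠ (nodeᵗ 3 𝟘 𝟘) x0 𝟙)
  ∧ ∀⁵ (Valᶠ x4 x2 x1 ⇒ Valᶠ x3 x2 x0 ⇒ Valᶠ (nodeᵗ 4 x4 x3) x2 (x1 ⊕ x0))
  ∧ ∀⁵ (Valᶠ x4 x2 x1 ⇒ Valᶠ x3 x2 x0 ⇒ Valᶠ (nodeᵗ 5 x4 x3) x2 (x1 ⊗ x0))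
  ∧ ∀⁵ (Valᶠ x4 x2 x1 ⇒ Valᶠ x3 x2 x0 ⇒ (Trueᶠ (nodeᵗ 0 x4 x3) x2 ⇔ᶠ (x1 ≐ᶠ x0)))
  ∧ ∀⁵ (Valᶠ x4 x2 x1 ⇒ Valᶠ x3 x2 x0 ⇒ (Trueᶠ (nodeᵗ 1 x4 x3) x2 ⇔ᶠ (x1 <ᶠ x0)))
  ∧ ∀³ (Valᶠ x2 x1 x0 ⇒ (Trueᶠ (nodeᵗ 2 x2 𝟘) x1 ⇔ᶠ Setᶠ x0))
  ∧ ∀² (Trueᶠ (nodeᵗ 3 x1 𝟘) x0 ⇔ᶠ (¬ᶠ Trueᶠ x1 x0))
  ∧ ∀³ (Trueᶠ (nodeᵗ 4 x2 x1) x0 ⇔ᶠ (Trueᶠ x2 x0 ∧ᶠ Trueᶠ x1 x0))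
  ∧ ∀³ (Trueᶠ (nodeᵗ 5 x2 x1) x0 ⇔ᶠ (Trueᶠ x2 x0 ∨ᶠ Trueᶠ x1 x0))
  ∧ ∀³ (Trueᶠ (nodeᵗ 6 x2 x1) x0 ⇔ᶠ (Trueᶠ x2 x0 ⇒ᶠ Trueᶠ x1 x0))
  ∧ ∀² (Trueᶠ (nodeᵗ 7 x1 𝟘) x0 ⇔ᶠ (∀ᶠ Trueᶠ x2 (consᵗ x0 x1)))
  ∧ ∀² (Trueᶠ (nodeᵗ 8 x1 𝟘) x0 ⇔ᶠ (∃ᶠ Trueᶠ x2 (consᵗ x0 x1)))

module Truth (Z M : Cantor) (column : ∀ n → Z (enc (2 ∷ n ∷ [])) ≡ M n) where

  Value : ℕ → ℕ → ℕ → Set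
  Value t v n = Z (enc (0 ∷ t ∷ v ∷ n ∷ [])) ≡ true

  True : ℕ → ℕ → Set
  True a v = Z (enc (1 ∷ a ∷ v ∷ [])) ≡ true

  module _ (ax : Sat Z [] tarski) where

    private
      var-zero  = ax .proj₁
      var-suc   = ax .proj₂ .proj₁
      zero-val  = ax .proj₂ .proj₂ .proj₁
      one-val   = ax .proj₂ .proj₂ .proj₂ .proj₁
      plus-val  = ax .proj₂ .proj₂ .proj₂ .proj₂ .proj₁
      times-val = ax .proj₂ .proj₂ .proj₂ .proj₂ .proj₂ .proj₁
      equals    = ax .proj₂ .proj₂ .proj₂ .proj₂ .proj₂ .proj₂ .proj₁
      precedes  = ax .proj₂ .proj₂ .proj₂ .proj₂ .proj₂ .proj₂ .proj₂ .proj₁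
      member    = ax .proj₂ .proj₂ .proj₂ .proj₂ .proj₂ .proj₂ .proj₂ .proj₂ .proj₁
      not       = ax .proj₂ .proj₂ .proj₂ .proj₂ .proj₂ .proj₂ .proj₂ .proj₂ .proj₂ .proj₁
      and       = ax .proj₂ .proj₂ .proj₂ .proj₂ .proj₂ .proj₂ .proj₂ .proj₂ .proj₂ .proj₂ .proj₁
      or        = ax .proj₂ .proj₂ .proj₂ .proj₂ .proj₂ .proj₂ .proj₂ .proj₂ .proj₂ .proj₂ .proj₂ .proj₁
      implies   = ax .proj₂ .proj₂ .proj₂ .proj₂ .proj₂ .proj₂ .proj₂ .proj₂ .proj₂ .proj₂ .proj₂ .proj₂ .proj₁
      all       = ax .proj₂ .proj₂ .proj₂ .proj₂ .proj₂ .proj₂ .proj₂ .proj₂ .proj₂ .proj₂ .proj₂ .proj₂ .proj₂ .proj₁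
      some      = ax .proj₂ .proj₂ .proj₂ .proj₂ .proj₂ .proj₂ .proj₂ .proj₂ .proj₂ .proj₂ .proj₂ .proj₂ .proj₂ .proj₂

    lookup-value : ∀ {k} (i : Fin k) v → Value ⌜ i ⌝ᵛ ⌜ v ⌝ᵉ (Vec.lookup v i)
    lookup-value zero    (n ∷ v) = var-zero n ⌜ v ⌝ᵉ
    lookup-value (suc i) (n ∷ v) =
      var-suc ⌜ i ⌝ᵛ n ⌜ v ⌝ᵉ (Vec.lookup v i) (lookup-value i v)

    -- The atomic clauses apply to any recorded values, so it is enough that the correct value is
    -- among them.
    value : ∀ {k} (t : Term k) v → Value ⌜ t ⌝ᵗ ⌜ v ⌝ᵉ (⟦ t ⟧ v)
    value (var i) v = lookup-value i v
    value 𝟘       v = zero-val ⌜ v ⌝ᵉ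
    value 𝟙       v = one-val ⌜ v ⌝ᵉ
    value (s ⊕ t) v =
      plus-val ⌜ s ⌝ᵗ ⌜ t ⌝ᵗ ⌜ v ⌝ᵉ (⟦ s ⟧ v) (⟦ t ⟧ v) (value s v) (value t v)
    value (s ⊗ t) v =
      times-val ⌜ s ⌝ᵗ ⌜ t ⌝ᵗ ⌜ v ⌝ᵉ (⟦ s ⟧ v) (⟦ t ⟧ v) (value s v) (value t v)

    -- Simultaneous induction on the formula, since negation and implication exchange the two
    -- directions.
    true⇒sat : ∀ {k} (φ : Formula k) v → True ⌜ φ ⌝ᶠ ⌜ v ⌝ᵉ → Sat M v φ
    sat⇒true : ∀ {k} (φ : Formula k) v → Sat M v φ → True ⌜ φ ⌝ᶠ ⌜ v ⌝ᵉ

    true⇒sat (s ≐ᶠ t) v p =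
      proj₁ (equals ⌜ s ⌝ᵗ ⌜ t ⌝ᵗ ⌜ v ⌝ᵉ _ _ (value s v) (value t v)) p
    true⇒sat (s <ᶠ t) v p =
      proj₁ (precedes ⌜ s ⌝ᵗ ⌜ t ⌝ᵗ ⌜ v ⌝ᵉ _ _ (value s v) (value t v)) p
    true⇒sat (t ∈Z) v p =
      trans (sym (column _)) (proj₁ (member ⌜ t ⌝ᵗ ⌜ v ⌝ᵉ (⟦ t ⟧ v) (value t v)) p)
    true⇒sat (¬ᶠ φ) v p q =
      proj₁ (not ⌜ φ ⌝ᶠ ⌜ v ⌝ᵉ) p (sat⇒true φ v q)
    true⇒sat (φ ∧ᶠ ψ) v p =
      let q = proj₁ (and ⌜ φ ⌝ᶠ ⌜ ψ ⌝ᶠ ⌜ v ⌝ᵉ) p in true⇒sat φ v (proj₁ q) , true⇒sat ψ v (proj₂ q)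
    true⇒sat (φ ∨ᶠ ψ) v p =
      [ inj₁ ∘ true⇒sat φ v , inj₂ ∘ true⇒sat ψ v ]′ (proj₁ (or ⌜ φ ⌝ᶠ ⌜ ψ ⌝ᶠ ⌜ v ⌝ᵉ) p)
    true⇒sat (φ ⇒ᶠ ψ) v p q =
      true⇒sat ψ v (proj₁ (implies ⌜ φ ⌝ᶠ ⌜ ψ ⌝ᶠ ⌜ v ⌝ᵉ) p (sat⇒true φ v q))
    true⇒sat (∀ᶠ φ) v p n =
      true⇒sat φ (n ∷ v) (proj₁ (all ⌜ φ ⌝ᶠ ⌜ v ⌝ᵉ) p n)
    true⇒sat (∃ᶠ φ) v p =
      let n , q = proj₁ (some ⌜ φ ⌝ᶠ ⌜ v ⌝ᵉ) p in n , true⇒sat φ (n ∷ v) q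

    sat⇒true (s ≐ᶠ t) v p =
      proj₂ (equals ⌜ s ⌝ᵗ ⌜ t ⌝ᵗ ⌜ v ⌝ᵉ _ _ (value s v) (value t v)) p
    sat⇒true (s <ᶠ t) v p =
      proj₂ (precedes ⌜ s ⌝ᵗ ⌜ t ⌝ᵗ ⌜ v ⌝ᵉ _ _ (value s v) (value t v)) p
    sat⇒true (t ∈Z) v p =
      proj₂ (member ⌜ t ⌝ᵗ ⌜ v ⌝ᵉ (⟦ t ⟧ v) (value t v)) (trans (column _) p)
    sat⇒true (¬ᶠ φ) v p =
      proj₂ (not ⌜ φ ⌝ᶠ ⌜ v ⌝ᵉ) (p ∘ true⇒sat φ v)
    sat⇒true (φ ∧ᶠ ψ) v (p , q) =
      proj₂ (and ⌜ φ ⌝ᶠ ⌜ ψ ⌝ᶠ ⌜ v ⌝ᵉ) (sat⇒true φ v p , sat⇒true ψ v q)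
    sat⇒true (φ ∨ᶠ ψ) v p =
      proj₂ (or ⌜ φ ⌝ᶠ ⌜ ψ ⌝ᶠ ⌜ v ⌝ᵉ) ([ inj₁ ∘ sat⇒true φ v , inj₂ ∘ sat⇒true ψ v ]′ p)
    sat⇒true (φ ⇒ᶠ ψ) v p =
      proj₂ (implies ⌜ φ ⌝ᶠ ⌜ ψ ⌝ᶠ ⌜ v ⌝ᵉ) (sat⇒true ψ v ∘ p ∘ true⇒sat φ v)
    sat⇒true (∀ᶠ φ) v p =
      proj₂ (all ⌜ φ ⌝ᶠ ⌜ v ⌝ᵉ) (λ n → sat⇒true φ (n ∷ v) (p n))
    sat⇒true (∃ᶠ φ) v (n , p) =
      proj₂ (some ⌜ φ ⌝ᶠ ⌜ v ⌝ᵉ) (n , sat⇒true φ (n ∷ v) p)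

-- Formulas with all membership atoms t ∈ Z replaced by ⟨x, t⟩ ∈ Z, x being a
-- fresh variable placed after those of the formula, and followed by m more.

liftᵗ : ∀ {k} m → Term k → Term (k + m)
liftᵗ m (var i) = var (i ↑ˡ m)
liftᵗ m 𝟘       = 𝟘
liftᵗ m 𝟙       = 𝟙
liftᵗ m (s ⊕ t) = liftᵗ m s ⊕ liftᵗ m t
liftᵗ m (s ⊗ t) = liftᵗ m s ⊗ liftᵗ m t

section : ∀ {k} m → Formula k → Formula (k + suc m)
section m (s ≐ᶠ t)     = liftᵗ (suc m) s ≐ᶠ liftᵗ (suc m) t
section m (s <ᶠ t)     = liftᵗ (suc m) s <ᶠ liftᵗ (suc m) t
section {k} m (t ∈Z)   = encᵗ (num 0 ∷ var (k ↑ʳ zero) ∷ liftᵗ (suc m) t ∷ []) ∈Z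
section m (¬ᶠ φ)       = ¬ᶠ section m φ
section m (φ ∧ᶠ ψ)     = section m φ ∧ᶠ section m ψ
section m (φ ∨ᶠ ψ)     = section m φ ∨ᶠ section m ψ
section m (φ ⇒ᶠ ψ)     = section m φ ⇒ᶠ section m ψ
section m (∀ᶠ φ)       = ∀ᶠ section m φ
section m (∃ᶠ φ)       = ∃ᶠ section m φ

⟦liftᵗ⟧ : ∀ {k m} (t : Term k) v (w : Vec ℕ m) → ⟦ liftᵗ m t ⟧ (v Vec.++ w) ≡ ⟦ t ⟧ v
⟦liftᵗ⟧ (var i) v w = lookup-++ˡ v w i
⟦liftᵗ⟧ 𝟘       v w = refl
⟦liftᵗ⟧ 𝟙       v w = refl
⟦liftᵗ⟧ (s ⊕ t) v w = cong₂ _+_ (⟦liftᵗ⟧ s v w) (⟦liftᵗ⟧ t v w)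
⟦liftᵗ⟧ (s ⊗ t) v w = cong₂ _*_ (⟦liftᵗ⟧ s v w) (⟦liftᵗ⟧ t v w)

module Section {m} (Z M : Cantor) (x : ℕ) (w : Vec ℕ m)
  (agree : ∀ n → Z (enc (0 ∷ x ∷ n ∷ [])) ≡ M n) where

  section⇒ : ∀ {k} (φ : Formula k) v → Sat Z (v Vec.++ x ∷ w) (section m φ) → Sat M v φ
  section⇐ : ∀ {k} (φ : Formula k) v → Sat M v φ → Sat Z (v Vec.++ x ∷ w) (section m φ)

  atom : ∀ {k} (t : Term k) v →
         Z (⟦ encᵗ (num 0 ∷ var (k ↑ʳ zero) ∷ liftᵗ (suc m) t ∷ []) ⟧ (v Vec.++ x ∷ w)) ≡ M (⟦ t ⟧ v)
  atom t v = trans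
    (cong₂ (λ y n → Z (enc (0 ∷ y ∷ n ∷ []))) (lookup-++ʳ v (x ∷ w) zero) (⟦liftᵗ⟧ t v (x ∷ w))) (agree (⟦ t ⟧ v))

  section⇒ (s ≐ᶠ t) v p = trans (sym (⟦liftᵗ⟧ s v (x ∷ w))) (trans p (⟦liftᵗ⟧ t v (x ∷ w)))
  section⇒ (s <ᶠ t) v p = subst₂ _<_ (⟦liftᵗ⟧ s v (x ∷ w)) (⟦liftᵗ⟧ t v (x ∷ w)) p
  section⇒ (t ∈Z) v p = trans (sym (atom t v)) p
  section⇒ (¬ᶠ φ) v p = p ∘ section⇐ φ v
  section⇒ (φ ∧ᶠ ψ) v (p , q) = section⇒ φ v p , section⇒ ψ v q
  section⇒ (φ ∨ᶠ ψ) v = Sum.map (section⇒ φ v) (section⇒ ψ v)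
  section⇒ (φ ⇒ᶠ ψ) v p = section⇒ ψ v ∘ p ∘ section⇐ φ v
  section⇒ (∀ᶠ φ) v p n = section⇒ φ (n ∷ v) (p n)
  section⇒ (∃ᶠ φ) v (n , p) = n , section⇒ φ (n ∷ v) p

  section⇐ (s ≐ᶠ t) v p = trans (⟦liftᵗ⟧ s v (x ∷ w)) (trans p (sym (⟦liftᵗ⟧ t v (x ∷ w))))
  section⇐ (s <ᶠ t) v p = subst₂ _<_ (sym (⟦liftᵗ⟧ s v (x ∷ w))) (sym (⟦liftᵗ⟧ t v (x ∷ w))) p
  section⇐ (t ∈Z) v p = trans (atom t v) p
  section⇐ (¬ᶠ φ) v p = p ∘ section⇒ φ v
  section⇐ (φ ∧ᶠ ψ) v (p , q) = section⇐ φ v p , section⇐ ψ v q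
  section⇐ (φ ∨ᶠ ψ) v = Sum.map (section⇐ φ v) (section⇐ ψ v)
  section⇐ (φ ⇒ᶠ ψ) v p = section⇐ ψ v ∘ p ∘ section⇒ φ v
  section⇐ (∀ᶠ φ) v p n = section⇐ φ (n ∷ v) (p n)
  section⇐ (∃ᶠ φ) v (n , p) = n , section⇐ φ (n ∷ v) p

-- A truth predicate exists over every set M.

module _ (em : ∀ ℓ → ExcludedMiddle ℓ) where

  module Coded (P : List ℕ → Set) where

    coded : Cantor
    coded z = does (em 0ℓ {∃[ l ] z ≡ enc l × P l})

    coded-sound : ∀ l → coded (enc l) ≡ true → P l
    coded-sound l eq with em 0ℓ {∃[ l′ ] enc l ≡ enc l′ × P l′}
    coded-sound l _  | yes (l′ , eq , p) = subst P (sym (enc-injective l l′ eq)) p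
    coded-sound l () | no _

    coded-complete : ∀ l → P l → coded (enc l) ≡ true
    coded-complete l p with em 0ℓ {∃[ l′ ] enc l ≡ enc l′ × P l′}
    ... | yes _ = refl
    ... | no ¬q = contradiction (l , refl , p) ¬q

  open Coded public

  -- Junk: numbers that are not pairs have both projections 0.
  unpair : ℕ → ℕ × ℕ
  unpair z with em 0ℓ {∃[ x ] ∃[ y ] z ≡ pair x y}
  ... | yes (x , y , _) = x , y
  ... | no  _           = 0 , 0

  unpair-pair : ∀ x y → unpair (pair x y) ≡ (x , y)
  unpair-pair x y with em 0ℓ {∃[ x′ ] ∃[ y′ ] pair x y ≡ pair x′ y′}
  ... | no ¬p = contradiction (x , y , refl) ¬p
  ... | yes (x′ , y′ , eq) with pair-injective x y x′ y′ eq
  ...   | refl , refl = refl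

  unpair≤ : ∀ z → proj₁ (unpair (suc z)) ≤ z × proj₂ (unpair (suc z)) ≤ z
  unpair≤ z with em 0ℓ {∃[ x ] ∃[ y ] suc z ≡ pair x y}
  ... | no _ = z≤n , z≤n
  ... | yes (x , y , eq) = s≤s⁻¹ (subst (x <_) (sym eq) (fst<pair x y))
                         , s≤s⁻¹ (subst (y <_) (sym eq) (snd<pair x y))

  -- The clauses of `tarski` quantify over all numbers, not only over codes of well-scoped formulas.
  -- Satisfaction is therefore defined on untyped trees, into which every number decodes.
  data Tree : Set where
    leaf   : Tree
    branch : ℕ → Tree → Tree → Tree

  label left right : ℕ → ℕ
  label z = proj₁ (unpair z)
  left  z = proj₁ (unpair (proj₂ (unpair z)))
  right z = proj₂ (unpair (proj₂ (unpair z)))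

  unpair≤′ : ∀ z → proj₁ (unpair z) ≤ z × proj₂ (unpair z) ≤ z
  unpair≤′ zero with em 0ℓ {∃[ x ] ∃[ y ] 0 ≡ pair x y}
  ... | no _ = z≤n , z≤n
  ... | yes (x , y , eq) = contradiction (trans eq (pair-suc x y)) 0≢1+n
  unpair≤′ (suc z) = let p , q = unpair≤ z in m≤n⇒m≤1+n p , m≤n⇒m≤1+n q

  left≤ : ∀ z → left (suc z) ≤ z
  left≤ z = ≤-trans (proj₁ (unpair≤′ _)) (proj₂ (unpair≤ z))

  right≤ : ∀ z → right (suc z) ≤ z
  right≤ z = ≤-trans (proj₂ (unpair≤′ _)) (proj₂ (unpair≤ z))

  -- The first argument bounds the recursion.
  decode′ : ℕ → ℕ → Tree
  decode′ zero    _       = leaf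
  decode′ (suc n) zero    = leaf
  decode′ (suc n) (suc z) =
    branch (label (suc z)) (decode′ n (left (suc z))) (decode′ n (right (suc z)))

  decode : ℕ → Tree
  decode z = decode′ z z

  decode′-stable : ∀ {z} n n′ → z ≤ n → z ≤ n′ → decode′ n z ≡ decode′ n′ z
  decode′-stable {zero}  zero    zero     p q = refl
  decode′-stable {zero}  zero    (suc n′) p q = refl
  decode′-stable {zero}  (suc n) zero     p q = refl
  decode′-stable {zero}  (suc n) (suc n′) p q = refl
  decode′-stable {suc z} (suc n) (suc n′) (s≤s p) (s≤s q) = cong₂ (branch _)
    (decode′-stable n n′ (≤-trans (left≤ z) p) (≤-trans (left≤ z) q))
    (decode′-stable n n′ (≤-trans (right≤ z) p) (≤-trans (right≤ z) q))

  decode-suc : ∀ z → decode (suc z) ≡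
    branch (label (suc z)) (decode (left (suc z))) (decode (right (suc z)))
  decode-suc z = cong₂ (branch _)
    (decode′-stable z (left (suc z)) (left≤ z) ≤-refl)
    (decode′-stable z (right (suc z)) (right≤ z) ≤-refl)

  decode-node : ∀ i a b → decode (node i a b) ≡ branch i (decode a) (decode b)
  decode-node i a b = trans (step (pair-suc i (pair a b))) fields
    where
    step : ∀ {z w} → z ≡ suc w → decode z ≡ branch (label z) (decode (left z)) (decode (right z))
    step {w = w} refl = decode-suc w
    fields : branch (label (node i a b)) (decode (left (node i a b))) (decode (right (node i a b)))
             ≡ branch i (decode a) (decode b)
    fields rewrite unpair-pair i (pair a b) | unpair-pair a b = refl

  evalᵗ : Tree → Tree → ℕ
  evalᵗ (branch 0 _ _) (branch n _ _) = n
  evalᵗ (branch 1 t _) (branch _ _ v) = evalᵗ t v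
  evalᵗ (branch 3 _ _) _              = 1
  evalᵗ (branch 4 s t) v              = evalᵗ s v + evalᵗ t v
  evalᵗ (branch 5 s t) v              = evalᵗ s v * evalᵗ t v
  -- Tag 2, the constant `𝟘`, falls under this default together with all junk.
  evalᵗ _              _              = 0

  satᵗ : Cantor → Tree → Tree → Set
  satᵗ M (branch 0 s t) v = evalᵗ s v ≡ evalᵗ t v
  satᵗ M (branch 1 s t) v = evalᵗ s v < evalᵗ t v
  satᵗ M (branch 2 t _) v = M (evalᵗ t v) ≡ true
  satᵗ M (branch 3 φ _) v = ¬ satᵗ M φ v
  satᵗ M (branch 4 φ ψ) v = satᵗ M φ v × satᵗ M ψ v
  satᵗ M (branch 5 φ ψ) v = satᵗ M φ v ⊎ satᵗ M ψ v
  satᵗ M (branch 6 φ ψ) v = satᵗ M φ v → satᵗ M ψ v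
  satᵗ M (branch 7 φ _) v = ∀ n → satᵗ M φ (branch n leaf v)
  satᵗ M (branch 8 φ _) v = ∃[ n ] satᵗ M φ (branch n leaf v)
  satᵗ M _              _ = ⊥

  module Model (M : Cantor) where

    Column : List ℕ → Set
    Column (0 ∷ t ∷ v ∷ n ∷ []) = evalᵗ (decode t) (decode v) ≡ n
    Column (1 ∷ a ∷ v ∷ [])     = satᵗ M (decode a) (decode v)
    Column (2 ∷ n ∷ [])         = M n ≡ true
    Column _                    = ⊥

    model : Cantor
    model = coded Column

    model-column : ∀ n → model (enc (2 ∷ n ∷ [])) ≡ M n
    model-column n with M n in eq
    ... | true  = coded-complete Column (2 ∷ n ∷ []) eq
    ... | false with model (enc (2 ∷ n ∷ [])) in eq′
    ...   | false = refl
    ...   | true  = trans (sym (coded-sound Column (2 ∷ n ∷ []) eq′)) eq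

    private
      Value : ℕ → ℕ → ℕ → Set
      Value t v n = model (enc (0 ∷ t ∷ v ∷ n ∷ [])) ≡ true

      True : ℕ → ℕ → Set
      True a v = model (enc (1 ∷ a ∷ v ∷ [])) ≡ true

      val-in : ∀ {t v n} → evalᵗ (decode t) (decode v) ≡ n → Value t v n
      val-in {t} {v} {n} = coded-complete Column (0 ∷ t ∷ v ∷ n ∷ [])

      val-out : ∀ t v n → Value t v n → evalᵗ (decode t) (decode v) ≡ n
      val-out t v n = coded-sound Column (0 ∷ t ∷ v ∷ n ∷ [])

      true-in : ∀ a v → satᵗ M (decode a) (decode v) → True a v
      true-in a v = coded-complete Column (1 ∷ a ∷ v ∷ [])

      true-out : ∀ a v → True a v → satᵗ M (decode a) (decode v)
      true-out a v = coded-sound Column (1 ∷ a ∷ v ∷ [])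

      node-value : ∀ i a b v {n} → evalᵗ (branch i (decode a) (decode b)) (decode v) ≡ n →
                   Value (node i a b) v n
      node-value i a b v p =
        val-in {node i a b} {v} (trans (cong (λ t → evalᵗ t (decode v)) (decode-node i a b)) p)

      node-in : ∀ i a b v → satᵗ M (branch i (decode a) (decode b)) (decode v) → True (node i a b) v
      node-in i a b v = true-in (node i a b) v
        ∘ subst (λ t → satᵗ M t (decode v)) (sym (decode-node i a b))

      node-out : ∀ i a b v → True (node i a b) v → satᵗ M (branch i (decode a) (decode b)) (decode v)
      node-out i a b v = subst (λ t → satᵗ M t (decode v)) (decode-node i a b)
        ∘ true-out (node i a b) v

      cons-in : ∀ a n v → satᵗ M (decode a) (branch n leaf (decode v)) → True a (cons n v)
      cons-in a n v = true-in a (cons n v) ∘ subst (satᵗ M (decode a)) (sym (decode-node n 0 v))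

      cons-out : ∀ a n v → True a (cons n v) → satᵗ M (decode a) (branch n leaf (decode v))
      cons-out a n v = subst (satᵗ M (decode a)) (decode-node n 0 v) ∘ true-out a (cons n v)

    model-tarski : Sat model [] tarski
    model-tarski =
        (λ n v → node-value 0 0 0 (cons n v) (cong (evalᵗ (branch 0 leaf leaf)) (decode-node n 0 v)))
      , (λ i n v m p → node-value 1 i 0 (cons n v)
          (trans (cong (evalᵗ (branch 1 (decode i) leaf)) (decode-node n 0 v)) (val-out i v m p)))
      , (λ v → node-value 2 0 0 v refl)
      , (λ v → node-value 3 0 0 v refl)
      , (λ s t v a b p q → node-value 4 s t v (cong₂ _+_ (val-out s v a p) (val-out t v b q)))
      , (λ s t v a b p q → node-value 5 s t v (cong₂ _*_ (val-out s v a p) (val-out t v b q)))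
      , (λ s t v a b p q →
            (λ r → trans (sym (val-out s v a p)) (trans (node-out 0 s t v r) (val-out t v b q)))
          , (λ r → node-in 0 s t v (trans (val-out s v a p) (trans r (sym (val-out t v b q))))))
      , (λ s t v a b p q →
            (λ r → subst₂ _<_ (val-out s v a p) (val-out t v b q) (node-out 1 s t v r))
          , (λ r → node-in 1 s t v (subst₂ _<_ (sym (val-out s v a p)) (sym (val-out t v b q)) r)))
      , (λ t v a p →
            (λ r → trans (model-column a) (trans (cong M (sym (val-out t v a p))) (node-out 2 t 0 v r)))
          , (λ r → node-in 2 t 0 v (trans (cong M (val-out t v a p)) (trans (sym (model-column a)) r))))
      , (λ a v → (λ r p → node-out 3 a 0 v r (true-out a v p))
               , (λ r → node-in 3 a 0 v (r ∘ true-in a v)))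
      , (λ a b v → (λ r → let p , q = node-out 4 a b v r in true-in a v p , true-in b v q)
                 , (λ (p , q) → node-in 4 a b v (true-out a v p , true-out b v q)))
      , (λ a b v → (λ r → Sum.map (true-in a v) (true-in b v) (node-out 5 a b v r))
                 , (λ r → node-in 5 a b v (Sum.map (true-out a v) (true-out b v) r)))
      , (λ a b v → (λ r p → true-in b v (node-out 6 a b v r (true-out a v p)))
                 , (λ r → node-in 6 a b v (true-out b v ∘ r ∘ true-in a v)))
      , (λ a v → (λ r n → cons-in a n v (node-out 7 a 0 v r n))
               , (λ r → node-in 7 a 0 v (λ n → cons-out a n v (r n))))
      , (λ a v → (λ r → let n , p = node-out 8 a 0 v r in n , cons-in a n v p)
               , (λ (n , p) → node-in 8 a 0 v (n , cons-out a n v p)))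

-- A universal Π¹₁ formula.

opaque
  -- The formula with code e is evaluated at (2 + e, τ, σ): the index also selects the test level,
  -- whose measure 2^-(e+2) leaves room for the factor 2 below the cap 2^-(e+1). Opacity keeps this
  -- large formula folded in later types.
  universal : Formula 3
  universal = tarski ⇒ Trueᶠ x0 (consᵗ (num 2 ⊕ x0) (consᵗ x1 (consᵗ x2 𝟘)))

  -- From left to right, a given M is completed to a model of the clauses. From right to left,
  -- column 2 of a given `Z` serves as M.
  universal-correct : (∀ ℓ → ExcludedMiddle ℓ) → (φ : Formula 3) → ∀ τ σ →
    (∀ Z → Sat Z (⌜ φ ⌝ᶠ ∷ τ ∷ σ ∷ []) universal) ⇔ (∀ Z → Sat Z (2 + ⌜ φ ⌝ᶠ ∷ τ ∷ σ ∷ []) φ)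
  universal-correct em φ τ σ = mk⇔
    (λ h M → Truth.true⇒sat (model em M) M (model-column em M) (model-tarski em M) φ
      (2 + ⌜ φ ⌝ᶠ ∷ τ ∷ σ ∷ []) (h (model em M) (model-tarski em M)))
    (λ h Z ax → Truth.sat⇒true Z (λ n → Z (enc (2 ∷ n ∷ []))) (λ _ → refl) ax φ
      (2 + ⌜ φ ⌝ᶠ ∷ τ ∷ σ ∷ []) (h (λ n → Z (enc (2 ∷ n ∷ [])))))
    where open Model

-- The uniform enumeration

-- The first bit is the most significant one, unlike in `⌜_⌝`. So the cylinder of `σ` is the dyadic
-- interval from `val σ` to `1 + val σ` in units of 2^-|σ|.
val : Str → ℕ
val []          = 0
val (false ∷ σ) = val σ
val (true ∷ σ)  = 2 ^ length σ + val σ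

Numeric : ℕ → ℕ → ℕ → Set
Numeric s v p = ∃[ σ ] s ≡ ⌜ σ ⌝ × v ≡ val σ × p ≡ 2 ^ length σ

Prefix : ℕ → ℕ → Set
Prefix s t = ∃[ σ ] ∃[ ρ ] s ≡ ⌜ σ ⌝ × t ≡ ⌜ σ ++ ρ ⌝

-- The cell [j/q, (j+1)/q] lies in the interval [v/p, (v+1)/p].
Within : ℕ → ℕ → ℕ → ℕ → Set
Within v p q j = v * q < 1 + j * p × (1 + j) * p < 1 + (1 + v) * q

-- Count I k c: at least c of the cells j < k satisfy I.
data Count (I : ℕ → Set) : ℕ → ℕ → Set where
  none : Count I 0 0
  skip : ∀ {k c} → Count I k c → Count I (suc k) c
  hit  : ∀ {k c} → Count I k c → I k → Count I (suc k) (suc c)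

-- Total I q k e f s: s is a sum of e terms a_i with a_i ≤ 2 c_i, where c_i of the cells below k
-- satisfy I i, and a_i ≤ q / 2^(i+1); moreover f = 2^e.
data Total (I : ℕ → ℕ → Set) (q k : ℕ) : ℕ → ℕ → ℕ → Set where
  none : Total I q k 0 1 0
  add  : ∀ {e f s c a} → Total I q k e f s → Count (I e) k c → a < 1 + 2 * c →
         a * (2 * f) < 1 + q → Total I q k (suc e) (2 * f) (a + s)

-- The string `τ` bounds the oracle use: a fact counts only if its oracle part is a prefix of `τ`.
Inside : (ℕ → ℕ → ℕ → Set) → ℕ → ℕ → ℕ → ℕ → Set
Inside F τ q e j =
  ∃[ τ′ ] ∃[ σ ] ∃[ v ] ∃[ p ] F e τ′ σ × Prefix τ′ τ × Numeric σ v p × Within v p q j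

-- The point k/q witnesses that σ lies to the left of α: `k < s` gives k/q < h(k/q), and the last
-- inequality puts the right end of the interval of σ strictly before k/q. The string `r` certifies
-- that q is a power of 2.
Left : (ℕ → ℕ → ℕ → Set) → ℕ → ℕ → Set
Left F τ σ = ∃[ r ] ∃[ w ] ∃[ q ] ∃[ k ] ∃[ e ] ∃[ f ] ∃[ s ] ∃[ v ] ∃[ p ]
  Numeric r w q × Total (Inside F τ q) q k e f s × k < s × Numeric σ v p × (1 + v) * q < k * p

Fᶠ : ∀ {k} → Term k → Term k → Term k → Formula k
Fᶠ e τ σ = encᵗ (num 1 ∷ e ∷ τ ∷ σ ∷ []) ∈Z

Prefixᶠ : ∀ {k} → Term k → Term k → Formula k
Prefixᶠ s t = encᵗ (num 2 ∷ s ∷ t ∷ []) ∈Z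

Numericᶠ : ∀ {k} → Term k → Term k → Term k → Formula k
Numericᶠ s v p = encᵗ (num 3 ∷ s ∷ p ∷ v ∷ []) ∈Z

Countᶠ : ∀ {k} → Term k → Term k → Term k → Term k → Term k → Formula k
Countᶠ τ e q k c = encᵗ (num 4 ∷ k ∷ c ∷ τ ∷ e ∷ q ∷ []) ∈Z

Totalᶠ : ∀ {k} → Term k → Term k → Term k → Term k → Term k → Term k → Formula k
Totalᶠ τ q k e f s = encᵗ (num 5 ∷ e ∷ f ∷ s ∷ τ ∷ q ∷ k ∷ []) ∈Z

double : ∀ {k} → Term k → Term k
double t = num 2 ⊗ t

-- Column 0 of Z holds a set for each x = ⟨e, τ, σ⟩. The first clause lets (e, τ, σ) be a fact
-- unless that set refutes universal at (e, τ, σ); so only the facts true for every set can be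
-- derived from the clauses, although universal itself occurs negatively.
rules : Formula 2
rules =
    -- The order of quantifiers puts e, τ, σ into the three slots of `universal` and x into the
    -- fresh slot behind them; the 2 accounts for the two free variables of `rules`.
    ∀⁴ (x3 ≐ᶠ encᵗ (x0 ∷ x1 ∷ x2 ∷ []) ⇒ section 2 universal ⇒ Fᶠ x0 x1 x2)
  ∧ ∀³ (Numericᶠ x2 x1 x0 ⇒ Prefixᶠ 𝟘 x2)
  ∧ ∀² (Prefixᶠ x1 x0 ⇒ Prefixᶠ (𝟙 ⊕ double x1) (𝟙 ⊕ double x0))
  ∧ ∀² (Prefixᶠ x1 x0 ⇒ Prefixᶠ (num 2 ⊕ double x1) (num 2 ⊕ double x0))
  ∧ Numericᶠ 𝟘 𝟘 𝟙
  ∧ ∀³ (Numericᶠ x2 x1 x0 ⇒ Numericᶠ (𝟙 ⊕ double x2) x1 (double x0))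
  ∧ ∀³ (Numericᶠ x2 x1 x0 ⇒ Numericᶠ (num 2 ⊕ double x2) (x0 ⊕ x1) (double x0))
  ∧ ∀³ (Countᶠ x2 x1 x0 𝟘 𝟘)
  ∧ ∀⁵ (Countᶠ x4 x3 x2 x1 x0 ⇒ Countᶠ x4 x3 x2 (𝟙 ⊕ x1) x0)
  ∧ ∀⁹ (Countᶠ x8 x7 x6 x5 x4 ⇒ Fᶠ x7 x3 x2 ⇒ Prefixᶠ x3 x8 ⇒ Numericᶠ x2 x1 x0
          ⇒ (x1 ⊗ x6) <ᶠ (𝟙 ⊕ (x5 ⊗ x0)) ⇒ ((𝟙 ⊕ x5) ⊗ x0) <ᶠ (𝟙 ⊕ ((𝟙 ⊕ x1) ⊗ x6))
          ⇒ Countᶠ x8 x7 x6 (𝟙 ⊕ x5) (𝟙 ⊕ x4))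
  ∧ ∀³ (Totalᶠ x2 x1 x0 𝟘 𝟙 𝟘)
  ∧ ∀⁸ (Totalᶠ x7 x6 x5 x4 x3 x2 ⇒ Countᶠ x7 x4 x6 x5 x1
          ⇒ x0 <ᶠ (𝟙 ⊕ double x1) ⇒ (x0 ⊗ double x3) <ᶠ (𝟙 ⊕ x6)
          ⇒ Totalᶠ x7 x6 x5 (𝟙 ⊕ x4) (double x3) (x0 ⊕ x2))

goal : Formula 2
goal = ∃ᶠ ∃ᶠ ∃ᶠ ∃ᶠ ∃ᶠ ∃ᶠ ∃ᶠ ∃ᶠ ∃ᶠ
  ( Numericᶠ x8 x7 x6 ∧ Totalᶠ x9 x6 x5 x4 x3 x2 ∧ (x5 <ᶠ x2)
  ∧ Numericᶠ x10 x1 x0 ∧ (((𝟙 ⊕ x1) ⊗ x6) <ᶠ (x5 ⊗ x0)))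

Fact : ℕ → ℕ → ℕ → Set
Fact e τ σ = ∀ Z → Sat Z (e ∷ τ ∷ σ ∷ []) universal

-- The clauses derive exactly the intended relations.

module Derive (Z : Cantor) (a b : ℕ) (ax : Sat Z (a ∷ b ∷ []) rules) where

  private
    fact       = ax .proj₁
    pre-nil    = ax .proj₂ .proj₁
    pre-0      = ax .proj₂ .proj₂ .proj₁
    pre-1      = ax .proj₂ .proj₂ .proj₂ .proj₁
    num-nil    = ax .proj₂ .proj₂ .proj₂ .proj₂ .proj₁
    num-0      = ax .proj₂ .proj₂ .proj₂ .proj₂ .proj₂ .proj₁
    num-1      = ax .proj₂ .proj₂ .proj₂ .proj₂ .proj₂ .proj₂ .proj₁
    count-none = ax .proj₂ .proj₂ .proj₂ .proj₂ .proj₂ .proj₂ .proj₂ .proj₁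
    count-skip = ax .proj₂ .proj₂ .proj₂ .proj₂ .proj₂ .proj₂ .proj₂ .proj₂ .proj₁
    count-hit  = ax .proj₂ .proj₂ .proj₂ .proj₂ .proj₂ .proj₂ .proj₂ .proj₂ .proj₂ .proj₁
    total-none = ax .proj₂ .proj₂ .proj₂ .proj₂ .proj₂ .proj₂ .proj₂ .proj₂ .proj₂ .proj₂ .proj₁
    total-add  = ax .proj₂ .proj₂ .proj₂ .proj₂ .proj₂ .proj₂ .proj₂ .proj₂ .proj₂ .proj₂ .proj₂

  -- A fact holds for all sets, hence for the set that column 0 of `Z` stores under this triple.
  -- That is the premise of the first clause.
  derive-fact : ∀ e τ σ → Fact e τ σ → Z (enc (1 ∷ e ∷ τ ∷ σ ∷ [])) ≡ true
  derive-fact e τ σ h = fact x σ τ e refl (section⇐ universal (e ∷ τ ∷ σ ∷ []) (h M))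
    where
    x = enc (e ∷ τ ∷ σ ∷ [])
    M : Cantor
    M n = Z (enc (0 ∷ x ∷ n ∷ []))
    open Section Z M x (a ∷ b ∷ []) (λ _ → refl)

  derive-numeric : ∀ {s v p} → Numeric s v p → Z (enc (3 ∷ s ∷ p ∷ v ∷ [])) ≡ true
  derive-numeric (σ , refl , refl , refl) = go σ
    where
    go : ∀ σ → Z (enc (3 ∷ ⌜ σ ⌝ ∷ 2 ^ length σ ∷ val σ ∷ [])) ≡ true
    go []          = num-nil
    go (false ∷ σ) = num-0 ⌜ σ ⌝ (val σ) (2 ^ length σ) (go σ)
    go (true ∷ σ)  = num-1 ⌜ σ ⌝ (val σ) (2 ^ length σ) (go σ)

  derive-prefix : ∀ {s t} → Prefix s t → Z (enc (2 ∷ s ∷ t ∷ [])) ≡ true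
  derive-prefix (σ , ρ , refl , refl) = go σ
    where
    go : ∀ σ → Z (enc (2 ∷ ⌜ σ ⌝ ∷ ⌜ σ ++ ρ ⌝ ∷ [])) ≡ true
    go []          = pre-nil ⌜ ρ ⌝ (val ρ) (2 ^ length ρ) (derive-numeric (ρ , refl , refl , refl))
    go (false ∷ σ) = pre-0 ⌜ σ ⌝ ⌜ σ ++ ρ ⌝ (go σ)
    go (true ∷ σ)  = pre-1 ⌜ σ ⌝ ⌜ σ ++ ρ ⌝ (go σ)

  derive-count : ∀ {τ e q k c} → Count (Inside Fact τ q e) k c →
                 Z (enc (4 ∷ k ∷ c ∷ τ ∷ e ∷ q ∷ [])) ≡ true
  derive-count {τ} {e} {q} none = count-none τ e q
  derive-count {τ} {e} {q} (skip {k} {c} x) = count-skip τ e q k c (derive-count x)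
  derive-count {τ} {e} {q} (hit {k} {c} x (τ′ , σ , v , p , h , τ′≼τ , nσ , lo , hi)) =
    count-hit τ e q k c τ′ σ v p (derive-count x) (derive-fact e τ′ σ h) (derive-prefix τ′≼τ)
      (derive-numeric nσ) lo hi

  derive-total : ∀ {τ q k e f s} → Total (Inside Fact τ q) q k e f s →
                 Z (enc (5 ∷ e ∷ f ∷ s ∷ τ ∷ q ∷ k ∷ [])) ≡ true
  derive-total {τ} {q} {k} none = total-none τ q k
  derive-total {τ} {q} {k} (add {e} {f} {s} {c} {a} t x lo hi) =
    total-add τ q k e f s c a (derive-total t) (derive-count x) lo hi

  derive-goal : Left Fact a b → Sat Z (a ∷ b ∷ []) goal
  derive-goal (r , w , q , k , e , f , s , v , p , nr , t , k<s , nσ , lt) =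
    r , w , q , k , e , f , s , v , p ,
      derive-numeric nr , derive-total t , k<s , derive-numeric nσ , lt

Enumeration : Str × Str → Set
Enumeration x = ∀ Z → Sat Z (code₂ x) (rules ⇒ goal)

module _ (em : ∀ ℓ → ExcludedMiddle ℓ) where

  -- A set refuting `universal` at the coded triple, whenever there is one. With these sets in
  -- column 0, the premise of the first clause holds only at genuine facts.
  counterexample : ℕ → Cantor
  counterexample x with em 0ℓ {∃[ e ] ∃[ τ ] ∃[ σ ] ∃[ Z ]
    x ≡ enc (e ∷ τ ∷ σ ∷ []) × ¬ Sat Z (e ∷ τ ∷ σ ∷ []) universal}
  ... | yes (_ , _ , _ , Z , _) = Z
  ... | no _                    = λ _ → false

  counterexample-correct : ∀ e τ σ →
    Sat (counterexample (enc (e ∷ τ ∷ σ ∷ []))) (e ∷ τ ∷ σ ∷ []) universal → Fact e τ σ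
  counterexample-correct e τ σ h Z with em 0ℓ {∃[ e′ ] ∃[ τ′ ] ∃[ σ′ ] ∃[ Z ]
    enc (e ∷ τ ∷ σ ∷ []) ≡ enc (e′ ∷ τ′ ∷ σ′ ∷ []) × ¬ Sat Z (e′ ∷ τ′ ∷ σ′ ∷ []) universal}
  counterexample-correct e τ σ h Z | yes (e′ , τ′ , σ′ , Z′ , eq , ¬h)
    with enc-injective (e ∷ τ ∷ σ ∷ []) (e′ ∷ τ′ ∷ σ′ ∷ []) eq
  ... | refl = contradiction h ¬h
  counterexample-correct e τ σ h Z | no ¬ex with em 0ℓ {Sat Z (e ∷ τ ∷ σ ∷ []) universal}
  ... | yes p = p
  ... | no ¬p = contradiction (e , τ , σ , Z , refl , ¬p) ¬ex

  -- `Derive` puts columns 1 to 5 into every set closed under the clauses, so a closed set with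
  -- exactly these columns is least there.
  Column : List ℕ → Set
  Column (0 ∷ x ∷ n ∷ [])                 = counterexample x n ≡ true
  Column (1 ∷ e ∷ τ ∷ σ ∷ [])             = Fact e τ σ
  Column (2 ∷ s ∷ t ∷ [])                 = Prefix s t
  Column (3 ∷ s ∷ p ∷ v ∷ [])             = Numeric s v p
  Column (4 ∷ k ∷ c ∷ τ ∷ e ∷ q ∷ [])     = Count (Inside Fact τ q e) k c
  Column (5 ∷ e ∷ f ∷ s ∷ τ ∷ q ∷ k ∷ []) = Total (Inside Fact τ q) q k e f s
  Column _                                = ⊥

  least : Cantor
  least = coded em Column

  into : ∀ l → Column l → least (enc l) ≡ true
  into = coded-complete em Column

  out : ∀ l → least (enc l) ≡ true → Column l
  out = coded-sound em Column

  least-section : ∀ x n → least (enc (0 ∷ x ∷ n ∷ [])) ≡ counterexample x n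
  least-section x n with counterexample x n in eq
  ... | true  = into (0 ∷ x ∷ n ∷ []) eq
  ... | false with least (enc (0 ∷ x ∷ n ∷ [])) in eq′
  ...   | false = refl
  ...   | true  = trans (sym (out (0 ∷ x ∷ n ∷ []) eq′)) eq

  least-rules : ∀ a b → Sat least (a ∷ b ∷ []) rules
  least-rules a b =
      (λ { _ σ τ e refl h → into (1 ∷ e ∷ τ ∷ σ ∷ []) (counterexample-correct e τ σ
             (section⇒ (enc (e ∷ τ ∷ σ ∷ [])) universal (e ∷ τ ∷ σ ∷ []) h)) })
    , (λ t v p h → into (2 ∷ 0 ∷ t ∷ []) (let ρ , eq , _ = out (3 ∷ t ∷ p ∷ v ∷ []) h in
          [] , ρ , refl , eq))
    , (λ s t h → into (2 ∷ 1 + 2 * s ∷ 1 + 2 * t ∷ [])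
          (let σ , ρ , p , q = out (2 ∷ s ∷ t ∷ []) h in
           false ∷ σ , ρ , cong (λ x → 1 + 2 * x) p , cong (λ x → 1 + 2 * x) q))
    , (λ s t h → into (2 ∷ 2 + 2 * s ∷ 2 + 2 * t ∷ [])
          (let σ , ρ , p , q = out (2 ∷ s ∷ t ∷ []) h in
           true ∷ σ , ρ , cong (λ x → 2 + 2 * x) p , cong (λ x → 2 + 2 * x) q))
    , into (3 ∷ 0 ∷ 1 ∷ 0 ∷ []) ([] , refl , refl , refl)
    , (λ s v p h → into (3 ∷ 1 + 2 * s ∷ 2 * p ∷ v ∷ [])
          (let σ , x , y , z = out (3 ∷ s ∷ p ∷ v ∷ []) h in
           false ∷ σ , cong (λ x → 1 + 2 * x) x , y , cong (2 *_) z))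
    , (λ s v p h → into (3 ∷ 2 + 2 * s ∷ 2 * p ∷ p + v ∷ [])
          (let σ , x , y , z = out (3 ∷ s ∷ p ∷ v ∷ []) h in
           true ∷ σ , cong (λ x → 2 + 2 * x) x , cong₂ _+_ z y , cong (2 *_) z))
    , (λ τ e q → into (4 ∷ 0 ∷ 0 ∷ τ ∷ e ∷ q ∷ []) none)
    , (λ τ e q k c h → into (4 ∷ 1 + k ∷ c ∷ τ ∷ e ∷ q ∷ [])
          (skip (out (4 ∷ k ∷ c ∷ τ ∷ e ∷ q ∷ []) h)))
    , (λ τ e q k c τ′ σ v p h h₁ h₂ h₃ lo hi → into (4 ∷ 1 + k ∷ 1 + c ∷ τ ∷ e ∷ q ∷ [])
          (hit (out (4 ∷ k ∷ c ∷ τ ∷ e ∷ q ∷ []) h)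
            (τ′ , σ , v , p , out (1 ∷ e ∷ τ′ ∷ σ ∷ []) h₁ , out (2 ∷ τ′ ∷ τ ∷ []) h₂ ,
              out (3 ∷ σ ∷ p ∷ v ∷ []) h₃ , lo , hi)))
    , (λ τ q k → into (5 ∷ 0 ∷ 1 ∷ 0 ∷ τ ∷ q ∷ k ∷ []) none)
    , (λ τ q k e f s c a h h₁ lo hi → into (5 ∷ 1 + e ∷ 2 * f ∷ a + s ∷ τ ∷ q ∷ k ∷ [])
          (add (out (5 ∷ e ∷ f ∷ s ∷ τ ∷ q ∷ k ∷ []) h)
            (out (4 ∷ k ∷ c ∷ τ ∷ e ∷ q ∷ []) h₁) lo hi))
    where
    section⇒ : ∀ x {k} (φ : Formula k) v → Sat least (v Vec.++ x ∷ a ∷ b ∷ []) (section 2 φ) →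
               Sat (counterexample x) v φ
    section⇒ x = Section.section⇒ least (counterexample x) x (a ∷ b ∷ []) (least-section x)

  -- The goal is read off in the closed set `least`, where the columns mean what they should;
  -- conversely it is derived in every closed set.
  enumeration-correct : ∀ τ σ → Enumeration (τ , σ) ⇔ Left Fact ⌜ τ ⌝ ⌜ σ ⌝
  enumeration-correct τ σ = mk⇔ to (λ h Z ax → Derive.derive-goal Z ⌜ τ ⌝ ⌜ σ ⌝ ax h)
    where
    to : Enumeration (τ , σ) → Left Fact ⌜ τ ⌝ ⌜ σ ⌝
    to h with h least (least-rules ⌜ τ ⌝ ⌜ σ ⌝)
    ... | r , w , q , k , e , f , s , v , p , nr , t , k<s , nσ , lt =
      r , w , q , k , e , f , s , v , p , out (3 ∷ r ∷ q ∷ w ∷ []) nr ,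
      out (5 ∷ e ∷ f ∷ s ∷ ⌜ τ ⌝ ∷ q ∷ k ∷ []) t , k<s , out (3 ∷ ⌜ σ ⌝ ∷ p ∷ v ∷ []) nσ , lt

-- Outer measure and counting of cells

halves : ∀ d .{{_ : NonZero d}} .{{_ : NonZero (2 * d)}} → (ℤ.+ 1 / (2 * d)) ℚ.+ (ℤ.+ 1 / (2 * d)) ≡ ℤ.+ 1 / d
halves d@(suc d′) = ℚ.toℚᵘ-injective (begin
  ℚ.toℚᵘ ((ℤ.+ 1 / (2 * d)) ℚ.+ (ℤ.+ 1 / (2 * d)))
    ≈⟨ ℚ.toℚᵘ-homo-+ (ℤ.+ 1 / (2 * d)) (ℤ.+ 1 / (2 * d)) ⟩
  ℚ.toℚᵘ (ℤ.+ 1 / (2 * d)) ℚᵘ.+ ℚ.toℚᵘ (ℤ.+ 1 / (2 * d))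
    ≈⟨ ℚᵘ.+-cong (ℚ.toℚᵘ-fromℚᵘ u) (ℚ.toℚᵘ-fromℚᵘ u) ⟩
  u ℚᵘ.+ u
    ≈⟨ ℚᵘ.*≡* (cong ℤ.+_ (identity d′)) ⟩
  ℚᵘ.mkℚᵘ (ℤ.+ 1) d′
    ≈⟨ ℚ.toℚᵘ-fromℚᵘ (ℚᵘ.mkℚᵘ (ℤ.+ 1) d′) ⟨
  ℚ.toℚᵘ (ℤ.+ 1 / d) ∎)
  where
  open ℚᵘ.≃-Reasoning
  u = ℚᵘ.mkℚᵘ (ℤ.+ 1) (ℕ.pred (2 * d))
  identity : ∀ d′ → (1 * (2 * suc d′) + 1 * (2 * suc d′)) * suc d′ ≡ 1 * ((2 * suc d′) * (2 * suc d′))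
  identity = solve-∀

2^-half : ∀ n → (2^- suc n) ℚ.+ (2^- suc n) ≡ 2^- n
2^-half n = halves (2 ^ n) {{m^n≢0 2 n}} {{m^n≢0 2 (suc n)}}

2^-pos : ∀ n → 0ℚ ℚ.< 2^- n
2^-pos n = ℚ.positive⁻¹ (2^- n) {{ℚ.normalize-pos 1 (2 ^ n) {{m^n≢0 2 n}}}}

2^-nonneg : ∀ n → 0ℚ ℚ.≤ 2^- n
2^-nonneg n = ℚ.<⇒≤ (2^-pos n)

≤-addˡ : ∀ {p q} → 0ℚ ℚ.≤ p → q ℚ.≤ p ℚ.+ q
≤-addˡ {p} {q} h = subst (ℚ._≤ p ℚ.+ q) (ℚ.+-identityˡ q) (ℚ.+-monoˡ-≤ q h)

≤-addʳ : ∀ {p q} → 0ℚ ℚ.≤ p → q ℚ.≤ q ℚ.+ p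
≤-addʳ {p} {q} h = subst (ℚ._≤ q ℚ.+ p) (ℚ.+-identityʳ q) (ℚ.+-monoʳ-≤ q h)

+-interchange : ∀ a b c d → (a ℚ.+ b) ℚ.+ (c ℚ.+ d) ≡ (a ℚ.+ c) ℚ.+ (b ℚ.+ d)
+-interchange a b c d = begin
  (a ℚ.+ b) ℚ.+ (c ℚ.+ d) ≡⟨ ℚ.+-assoc a b _ ⟩
  a ℚ.+ (b ℚ.+ (c ℚ.+ d)) ≡⟨ cong (a ℚ.+_) (ℚ.+-assoc b c d) ⟨
  a ℚ.+ ((b ℚ.+ c) ℚ.+ d) ≡⟨ cong (λ x → a ℚ.+ (x ℚ.+ d)) (ℚ.+-comm b c) ⟩
  a ℚ.+ ((c ℚ.+ b) ℚ.+ d) ≡⟨ cong (a ℚ.+_) (ℚ.+-assoc c b d) ⟩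
  a ℚ.+ (c ℚ.+ (b ℚ.+ d)) ≡⟨ ℚ.+-assoc a c _ ⟨
  (a ℚ.+ c) ℚ.+ (b ℚ.+ d) ∎
  where open ≡-Reasoning

infixr 7 _·_

_·_ : ℕ → ℚ → ℚ
zero  · u = 0ℚ
suc c · u = u ℚ.+ c · u

·-distribʳ-+ : ∀ a b u → (a + b) · u ≡ a · u ℚ.+ b · u
·-distribʳ-+ zero    b u = sym (ℚ.+-identityˡ (b · u))
·-distribʳ-+ (suc a) b u =
  trans (cong (u ℚ.+_) (·-distribʳ-+ a b u)) (sym (ℚ.+-assoc u (a · u) (b · u)))

·-assoc : ∀ a b u → (a * b) · u ≡ a · (b · u)
·-assoc zero    b u = refl
·-assoc (suc a) b u = trans (·-distribʳ-+ b (a * b) u) (cong (b · u ℚ.+_) (·-assoc a b u))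

·-nonneg : ∀ a {u} → 0ℚ ℚ.≤ u → 0ℚ ℚ.≤ a · u
·-nonneg zero    h = ℚ.≤-refl
·-nonneg (suc a) h = ℚ.≤-trans h (≤-addʳ (·-nonneg a h))

·-monoˡ-≤ : ∀ {a b u} → 0ℚ ℚ.≤ u → a ≤ b → a · u ℚ.≤ b · u
·-monoˡ-≤ {b = b} h z≤n     = ·-nonneg b h
·-monoˡ-≤ {u = u} h (s≤s p) = ℚ.+-monoʳ-≤ u (·-monoˡ-≤ h p)

2^·2^- : ∀ k m → (2 ^ k) · (2^- (k + m)) ≡ 2^- m
2^·2^- zero    m = ℚ.+-identityʳ (2^- m)
2^·2^- (suc k) m = begin
  (2 ^ k + (2 ^ k + 0)) · (2^- suc (k + m))        ≡⟨ cong (λ x → (2 ^ k + x) · (2^- suc (k + m))) (+-identityʳ (2 ^ k)) ⟩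
  (2 ^ k + 2 ^ k) · (2^- suc (k + m))              ≡⟨ ·-distribʳ-+ (2 ^ k) (2 ^ k) _ ⟩
  (2 ^ k) · (2^- suc (k + m)) ℚ.+ (2 ^ k) · (2^- suc (k + m))
    ≡⟨ cong (λ x → (2 ^ k) · (2^- x) ℚ.+ (2 ^ k) · (2^- x)) (+-suc k m) ⟨
  (2 ^ k) · (2^- (k + suc m)) ℚ.+ (2 ^ k) · (2^- (k + suc m))
    ≡⟨ cong₂ ℚ._+_ (2^·2^- k (suc m)) (2^·2^- k (suc m)) ⟩
  (2^- suc m) ℚ.+ (2^- suc m)                      ≡⟨ 2^-half m ⟩
  2^- m                                            ∎
  where open ≡-Reasoning

-- meet n c ρ is 2^(-n) times the measure of [c] ∩ [ρ].
meet : ℕ → Str → Str → ℚ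
meet n []      ρ        = 2^- (n + length ρ)
meet n (b ∷ c) []       = 2^- (n + suc (length c))
meet n (b ∷ c) (b′ ∷ ρ) = if does (b ≟ᵇ b′) then meet (suc n) c ρ else 0ℚ

meet-[] : ∀ n c → meet n c [] ≡ 2^- (n + length c)
meet-[] n []      = refl
meet-[] n (b ∷ c) = refl

meet-split : ∀ n c ρ → meet n c (ρ ∷ʳ false) ℚ.+ meet n c (ρ ∷ʳ true) ≡ meet n c ρ
meet-split n [] ρ = begin
  2^- (n + length (ρ ∷ʳ false)) ℚ.+ 2^- (n + length (ρ ∷ʳ true))
    ≡⟨ cong₂ (λ x y → 2^- x ℚ.+ 2^- y) (len false) (len true) ⟩
  (2^- suc (n + length ρ)) ℚ.+ (2^- suc (n + length ρ))
    ≡⟨ 2^-half (n + length ρ) ⟩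
  2^- (n + length ρ) ∎
  where
  open ≡-Reasoning
  len : ∀ b → n + length (ρ ∷ʳ b) ≡ suc (n + length ρ)
  len b = trans (cong (n +_) (trans (length-++ ρ) (+-comm (length ρ) 1))) (+-suc n (length ρ))
meet-split n (false ∷ c) [] = trans (ℚ.+-identityʳ _)
  (trans (meet-[] (suc n) c) (cong 2^-_ (sym (+-suc n (length c)))))
meet-split n (true ∷ c)  [] = trans (ℚ.+-identityˡ _)
  (trans (meet-[] (suc n) c) (cong 2^-_ (sym (+-suc n (length c)))))
meet-split n (b ∷ c) (b′ ∷ ρ) with does (b ≟ᵇ b′)
... | true  = meet-split (suc n) c ρ
... | false = ℚ.+-identityˡ 0ℚ

meet-nonneg : ∀ n c ρ → 0ℚ ℚ.≤ meet n c ρ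
meet-nonneg n []      ρ  = 2^-nonneg (n + length ρ)
meet-nonneg n (b ∷ c) [] = 2^-nonneg (n + suc (length c))
meet-nonneg n (b ∷ c) (b′ ∷ ρ) with does (b ≟ᵇ b′)
... | true  = meet-nonneg (suc n) c ρ
... | false = ℚ.≤-refl

meet-prefix : ∀ n c δ → meet n c (c ++ δ) ≡ 2^- (n + length (c ++ δ))
meet-prefix n []          δ = refl
meet-prefix n (false ∷ c) δ =
  trans (meet-prefix (suc n) c δ) (cong 2^-_ (sym (+-suc n (length (c ++ δ)))))
meet-prefix n (true ∷ c)  δ =
  trans (meet-prefix (suc n) c δ) (cong 2^-_ (sym (+-suc n (length (c ++ δ)))))

module _ (c : ℕ → Str) where

  -- Overlaps among the cylinders are counted with multiplicity, so that the value at `[]` is the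
  -- weight of the cover, while additivity under splitting `ρ` is kept.
  mass : ℕ → Str → ℚ
  mass zero    ρ = 0ℚ
  mass (suc K) ρ = mass K ρ ℚ.+ meet 0 (c K) ρ

  mass-[] : ∀ K → mass K [] ≡ weight c K
  mass-[] zero    = refl
  mass-[] (suc K) = cong₂ ℚ._+_ (mass-[] K) (meet-[] 0 (c K))

  mass-split : ∀ K ρ → mass K (ρ ∷ʳ false) ℚ.+ mass K (ρ ∷ʳ true) ≡ mass K ρ
  mass-split zero    ρ = ℚ.+-identityˡ 0ℚ
  mass-split (suc K) ρ =
    trans (+-interchange (mass K (ρ ∷ʳ false)) (meet 0 (c K) (ρ ∷ʳ false))
                         (mass K (ρ ∷ʳ true)) (meet 0 (c K) (ρ ∷ʳ true)))
          (cong₂ ℚ._+_ (mass-split K ρ) (meet-split 0 (c K) ρ))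

  mass-nonneg : ∀ K ρ → 0ℚ ℚ.≤ mass K ρ
  mass-nonneg zero    ρ = ℚ.≤-refl
  mass-nonneg (suc K) ρ = ℚ.≤-trans (mass-nonneg K ρ) (≤-addʳ (meet-nonneg 0 (c K) ρ))

  mass-mono : ∀ {K K′} ρ → K ≤ K′ → mass K ρ ℚ.≤ mass K′ ρ
  mass-mono {K} ρ h with m≤n⇒∃[o]m+o≡n h
  ... | o , refl = go o
    where
    go : ∀ o → mass K ρ ℚ.≤ mass (K + o) ρ
    go zero    = ℚ.≤-reflexive (cong (λ x → mass x ρ) (sym (+-identityʳ K)))
    go (suc o) = ℚ.≤-trans (go o) (ℚ.≤-trans (≤-addʳ (meet-nonneg 0 (c (K + o)) ρ))
      (ℚ.≤-reflexive (cong (λ x → mass x ρ) (sym (+-suc K o)))))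

  -- Bounds reached with different numbers of cylinders hold together at the larger number. This is
  -- the bisection step of both `exhaust` and `tally≤mass`.
  mass-join : ∀ {x y} ρ → (∃[ K ] x ℚ.≤ mass K (ρ ∷ʳ false)) → (∃[ K ] y ℚ.≤ mass K (ρ ∷ʳ true)) →
              ∃[ K ] x ℚ.+ y ℚ.≤ mass K ρ
  mass-join ρ (K , p) (K′ , q) = K ℕ.⊔ K′ , subst (_ ℚ.≤_) (mass-split (K ℕ.⊔ K′) ρ)
    (ℚ.+-mono-≤ (ℚ.≤-trans p (mass-mono (ρ ∷ʳ false) (m≤m⊔n K K′)))
                (ℚ.≤-trans q (mass-mono (ρ ∷ʳ true) (m≤n⊔m K K′))))

-- Initial segments and dyadic intervals.

prepend : Str → Cantor → Cantor
prepend []      Y n       = Y n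
prepend (b ∷ ρ) Y zero    = b
prepend (b ∷ ρ) Y (suc n) = prepend ρ Y n

applyUpTo-prepend : ∀ ρ Y n → applyUpTo (prepend ρ Y) (length ρ + n) ≡ ρ ++ applyUpTo Y n
applyUpTo-prepend []      Y n = refl
applyUpTo-prepend (b ∷ ρ) Y n = cong (b ∷_) (applyUpTo-prepend ρ Y n)

applyUpTo-+ : ∀ {A : Set} (X : ℕ → A) m n → applyUpTo X (m + n) ≡ applyUpTo X m ++ applyUpTo (X ∘ (m +_)) n
applyUpTo-+ X zero    n = refl
applyUpTo-+ X (suc m) n = cong (X 0 ∷_) (applyUpTo-+ (X ∘ suc) m n)

≺-prefix : ∀ {X σ} δ → (σ ++ δ) ≺ X → σ ≺ X
≺-prefix {σ = []}    δ _             = 0 , refl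
≺-prefix {σ = b ∷ σ} δ (suc n , eq)  with ≺-prefix {σ = σ} δ (n , ∷-injectiveʳ eq)
... | m , eq′ = suc m , cong₂ _∷_ (∷-injectiveˡ eq) eq′

len-snoc : ∀ (ρ : Str) b → length (ρ ∷ʳ b) ≡ suc (length ρ)
len-snoc ρ b = trans (length-++ ρ) (+-comm (length ρ) 1)

val-snoc-false : ∀ ρ → val (ρ ∷ʳ false) ≡ 2 * val ρ
val-snoc-false []          = refl
val-snoc-false (false ∷ ρ) = val-snoc-false ρ
val-snoc-false (true ∷ ρ)  rewrite len-snoc ρ false | val-snoc-false ρ = sym (*-distribˡ-+ 2 (2 ^ length ρ) (val ρ))

val-snoc-true : ∀ ρ → val (ρ ∷ʳ true) ≡ suc (2 * val ρ)
val-snoc-true []          = refl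
val-snoc-true (false ∷ ρ) = val-snoc-true ρ
val-snoc-true (true ∷ ρ)  rewrite len-snoc ρ true | val-snoc-true ρ = identity (2 ^ length ρ) (val ρ)
  where
  identity : ∀ a b → 2 * a + suc (2 * b) ≡ suc (2 * (a + b))
  identity = solve-∀

val< : ∀ σ → val σ < 2 ^ length σ
val< []          = s≤s z≤n
val< (false ∷ σ) = <-≤-trans (val< σ) (m≤m+n _ _)
val< (true ∷ σ)  = +-monoʳ-< (2 ^ length σ) (subst (val σ <_) (sym (+-identityʳ _)) (val< σ))

-- Dyadic intervals are nested or have disjoint interiors. Equal first bits are removed by rescaling
-- a half to the whole; different first bits place the intervals in different halves; and the unit
-- interval does not fit into a proper subinterval.
within⇒prefix : ∀ σ ρ → Within (val σ) (2 ^ length σ) (2 ^ length ρ) (val ρ) → ∃[ δ ] ρ ≡ σ ++ δ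
within⇒prefix []      ρ  _ = ρ , refl
within⇒prefix (b ∷ σ) [] (lo , hi) = contradiction
  (≤-trans (^-monoʳ-≤ 2 {1} {suc (length σ)} (s≤s z≤n)) (≤-trans (m≤m+n _ 0) (s≤s⁻¹ hi)))
  (<⇒≱ (s≤s (s≤s (≤-reflexive (n<1⇒n≡0 lo)))))
within⇒prefix (false ∷ σ) (false ∷ ρ) (s≤s lo , s≤s hi) =
  let δ , eq = within⇒prefix σ ρ (s≤s (halve (val σ) (val ρ) lo) , s≤s (halve′ (val ρ) (val σ) hi))
  in δ , cong (false ∷_) eq
  where
  p = 2 ^ length σ
  q = 2 ^ length ρ
  swap : ∀ a b → a * (2 * b) ≡ 2 * (a * b)
  swap = solve-∀
  halve : ∀ v j → v * (2 * q) ≤ j * (2 * p) → v * q ≤ j * p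
  halve v j h = *-cancelˡ-≤ 2 (subst₂ _≤_ (swap v q) (swap j p) h)
  halve′ : ∀ j v → (1 + j) * (2 * p) ≤ (1 + v) * (2 * q) → (1 + j) * p ≤ (1 + v) * q
  halve′ j v h = *-cancelˡ-≤ 2 (subst₂ _≤_ (swap (1 + j) p) (swap (1 + v) q) h)
within⇒prefix (true ∷ σ) (true ∷ ρ) (s≤s lo , s≤s hi) =
  let δ , eq = within⇒prefix σ ρ
        ( s≤s (cancel (subst₂ _≤_ (shift₁ p q (val σ)) (shift₂ p q (val ρ)) lo))
        , s≤s (cancel (subst₂ _≤_ (shift₃ p q (val ρ)) (shift₄ p q (val σ)) hi)))
  in δ , cong (true ∷_) eq
  where
  p = 2 ^ length σ
  q = 2 ^ length ρ
  cancel : ∀ {a b} → 2 * (p * q + a) ≤ 2 * (p * q + b) → a ≤ b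
  cancel h = +-cancelˡ-≤ (p * q) _ _ (*-cancelˡ-≤ 2 h)
  shift₁ : ∀ p q v → (p + v) * (2 * q) ≡ 2 * (p * q + v * q)
  shift₁ = solve-∀
  shift₂ : ∀ p q j → (q + j) * (2 * p) ≡ 2 * (p * q + j * p)
  shift₂ = solve-∀
  shift₃ : ∀ p q j → (1 + (q + j)) * (2 * p) ≡ 2 * (p * q + (1 + j) * p)
  shift₃ = solve-∀
  shift₄ : ∀ p q v → (1 + (p + v)) * (2 * q) ≡ 2 * (p * q + (1 + v) * q)
  shift₄ = solve-∀
within⇒prefix (false ∷ σ) (true ∷ ρ) (s≤s lo , s≤s hi) = contradiction
  (≤-trans hi (*-monoˡ-≤ (2 * q) (val< σ))) (<⇒≱ (begin-strict
    p * (2 * q)                          ≡⟨ swap p q ⟩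
    q * (2 * p)                          <⟨ *-monoˡ-< (2 * p) {{m^n≢0 2 (suc (length σ))}} (s≤s (m≤m+n q (val ρ))) ⟩
    (1 + (q + val ρ)) * (2 * p)          ∎))
  where
  open ≤-Reasoning
  p = 2 ^ length σ
  q = 2 ^ length ρ
  swap : ∀ p q → p * (2 * q) ≡ q * (2 * p)
  swap = solve-∀
within⇒prefix (true ∷ σ) (false ∷ ρ) (s≤s lo , s≤s hi) = contradiction lo (<⇒≱ (begin-strict
    val ρ * (2 * p)       <⟨ *-monoˡ-< (2 * p) {{m^n≢0 2 (suc (length σ))}} (val< ρ) ⟩
    q * (2 * p)           ≡⟨ swap p q ⟩
    p * (2 * q)           ≤⟨ *-monoˡ-≤ (2 * q) (m≤m+n p (val σ)) ⟩
    (p + val σ) * (2 * q) ∎))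
  where
  open ≤-Reasoning
  p = 2 ^ length σ
  q = 2 ^ length ρ
  swap : ∀ p q → q * (2 * p) ≡ p * (2 * q)
  swap = solve-∀

-- Counted cells against the weight of a cover.

count-mono : ∀ {I k k′ c} → k ≤ k′ → Count I k c → Count I k′ c
count-mono {I} {k} {c = c} h x with m≤n⇒∃[o]m+o≡n h
... | o , refl = go o
  where
  go : ∀ o → Count I (k + o) c
  go zero    = subst (λ k → Count I k c) (sym (+-identityʳ k)) x
  go (suc o) = subst (λ k → Count I k c) (sym (+-suc k o)) (skip (go o))

-- A count may run past the last cell of the unit interval, where nothing is hit; this cuts it back
-- before it is compared with a measure.
count-cap : ∀ {I M k c} → (∀ j → I j → j < M) → Count I k c → Count I M c
count-cap {M = M} bound x = count-mono (m⊓n≤n _ M) (go x)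
  where
  go : ∀ {k c} → Count _ k c → Count _ (k ⊓ M) c
  go none             = none
  go (skip {k} x)     = count-mono (⊓-monoˡ-≤ M (n≤1+n k)) (go x)
  go (hit {k} {c} x i) = subst (λ k → Count _ k (suc c)) (sym (m≤n⇒m⊓n≡m (bound k i)))
    (hit (subst (λ k → Count _ k c) (m≤n⇒m⊓n≡m (<⇒≤ (bound k i))) (go x)) i)

module _ (em : ∀ ℓ → ExcludedMiddle ℓ) where

  module _ (c : ℕ → Str) where

    -- Compactness: repeatedly halving a cylinder whose measure is not exhausted by finitely many c i
    -- leads to a point outside all of them.
    exhaust : ∀ ρ → (∀ X → ρ ≺ X → ∃[ i ] c i ≺ X) → ∃[ K ] 2^- (length ρ) ℚ.≤ mass c K ρ
    exhaust ρ covered with em 0ℓ {∃[ K ] 2^- (length ρ) ℚ.≤ mass c K ρ}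
    ... | yes p = p
    ... | no ¬p = 
      let h = covered X (≺-start ρ) in contradiction (exhausted h) (proj₂ (vertex (proj₁ (proj₂ h))))
      where
      Exhausted : Str → Set
      Exhausted ρ = ∃[ K ] 2^- (length ρ) ℚ.≤ mass c K ρ

      next : ∀ ρ → ¬ Exhausted ρ → ∃[ b ] ¬ Exhausted (ρ ∷ʳ b)
      next ρ ¬ex with em 0ℓ {Exhausted (ρ ∷ʳ false)} | em 0ℓ {Exhausted (ρ ∷ʳ true)}
      ... | no ¬l | _      = false , ¬l
      ... | yes _ | no ¬r  = true , ¬r
      ... | yes l | yes r  = contradiction (subst (λ x → ∃[ K ] x ℚ.≤ mass c K ρ)
        (trans (cong₂ (λ m n → 2^- m ℚ.+ 2^- n) (len-snoc ρ false) (len-snoc ρ true)) (2^-half (length ρ)))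
        (mass-join c ρ l r)) ¬ex

      vertex : ℕ → ∃[ σ ] ¬ Exhausted σ
      vertex zero    = ρ , ¬p
      vertex (suc n) = let σ , ¬ex = vertex n; b , ¬ex′ = next σ ¬ex in σ ∷ʳ b , ¬ex′

      Y : Cantor
      Y n = proj₁ (next (proj₁ (vertex n)) (proj₂ (vertex n)))

      X : Cantor
      X = prepend ρ Y

      ≺-start : ∀ ρ → ρ ≺ prepend ρ Y
      ≺-start ρ = length ρ + 0 , sym (trans (applyUpTo-prepend ρ Y 0) (++-identityʳ ρ))

      vertex-path : ∀ n → proj₁ (vertex n) ≡ applyUpTo X (length ρ + n)
      vertex-path n = trans (go n) (sym (applyUpTo-prepend ρ Y n))
        where
        go : ∀ n → proj₁ (vertex n) ≡ ρ ++ applyUpTo Y n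
        go zero    = sym (++-identityʳ ρ)
        go (suc n) = trans (cong (_∷ʳ Y n) (go n))
          (trans (++-assoc ρ (applyUpTo Y n) _) (cong (ρ ++_) (applyUpTo-∷ʳ Y n)))

      -- The cylinder `c i` is the initial segment of `X` of length m. The vertex at stage m has
      -- length |ρ| + m, so it extends `c i`, which alone then supplies its full measure.
      exhausted : (h : ∃[ i ] c i ≺ X) → Exhausted (proj₁ (vertex (proj₁ (proj₂ h))))
      exhausted (i , m , eq) = suc i , subst (λ σ → 2^- (length σ) ℚ.≤ mass c (suc i) σ) (sym path)
        (ℚ.≤-trans (ℚ.≤-reflexive (sym (meet-prefix 0 (c i) δ))) (≤-addˡ (mass-nonneg c i (c i ++ δ))))
        where
        δ : Str
        δ = applyUpTo (X ∘ (m +_)) (length ρ)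
        path : proj₁ (vertex m) ≡ c i ++ δ
        path = trans (vertex-path m) (trans (cong (applyUpTo X) (+-comm (length ρ) m))
          (trans (applyUpTo-+ X m (length ρ)) (cong (_++ δ) (sym eq))))

    module _ (V : Pred Str 0ℓ) (covered : ∀ X σ → σ ≺ X → V σ → ∃[ i ] c i ≺ X) (N : ℕ) where

      Hit : ℕ → Set
      Hit j = ∃[ σ ] V σ × Within (val σ) (2 ^ length σ) (2 ^ N) j

      hit? : ∀ j → Dec (Hit j)
      hit? j = em 0ℓ

      tally : ℕ → ℕ → ℕ
      tally s zero    = 0
      tally s (suc l) = (if does (hit? (s + l)) then 1 else 0) + tally s l

      tally-+ : ∀ s l l′ → tally s (l + l′) ≡ tally s l + tally (s + l) l′
      tally-+ s l zero = trans (cong (tally s) (+-identityʳ l)) (sym (+-identityʳ _))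
      tally-+ s l (suc l′) rewrite +-suc l l′ | tally-+ s l l′ | sym (+-assoc s l l′) =
        rearrange (if does (hit? (s + l + l′)) then 1 else 0) (tally s l) (tally (s + l) l′)
        where
        rearrange : ∀ a b c → a + (b + c) ≡ b + (a + c)
        rearrange = solve-∀

      count≤tally : ∀ {k a} → Count Hit k a → a ≤ tally 0 k
      count≤tally none = z≤n
      count≤tally (skip {k} x) = ≤-trans (count≤tally x) (m≤n+m _ _)
      count≤tally (hit {k} x h) with hit? k
      ... | yes _ = s≤s (count≤tally x)
      ... | no ¬h = contradiction h ¬h

      -- Bisection, with `d` halvings left. A hit cell of length 2^-N lies in a cylinder from `V`;
      -- all its points are covered, so `exhaust` yields its full measure.
      tally≤mass : ∀ d ρ → length ρ + d ≡ N →
                   ∃[ K ] tally (val ρ * 2 ^ d) (2 ^ d) · (2^- N) ℚ.≤ mass c K ρ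
      tally≤mass zero ρ eq with hit? (val ρ * 1 + 0)
      ... | no _ = 0 , ℚ.≤-refl
      ... | yes (σ , σ∈V , w) = subst (λ x → ∃[ K ] x ℚ.≤ mass c K ρ)
        (trans (cong 2^-_ N≡) (sym (ℚ.+-identityʳ (2^- N))))
        (exhaust ρ (λ X ρ≺X → covered X σ (≺-prefix δ (subst (_≺ X) ρ≡ ρ≺X)) σ∈V))
        where
        N≡ : length ρ ≡ N
        N≡ = trans (sym (+-identityʳ _)) eq
        prefix : ∃[ δ ] ρ ≡ σ ++ δ
        prefix = within⇒prefix σ ρ (subst₂ (λ M j → Within (val σ) (2 ^ length σ) (2 ^ M) j)
          (sym N≡) (trans (+-identityʳ (val ρ * 1)) (*-identityʳ (val ρ))) w)
        δ = proj₁ prefix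
        ρ≡ = proj₂ prefix
      tally≤mass (suc d) ρ eq = subst (λ x → ∃[ K ] x ℚ.≤ mass c K ρ) total
        (mass-join c ρ (tally≤mass d (ρ ∷ʳ false) (len false)) (tally≤mass d (ρ ∷ʳ true) (len true)))
        where
        D = 2 ^ d
        S = val ρ * 2 ^ suc d
        len : ∀ b → length (ρ ∷ʳ b) + d ≡ N
        len b = trans (cong (_+ d) (len-snoc ρ b)) (trans (sym (+-suc (length ρ) d)) eq)
        start₀ : val (ρ ∷ʳ false) * D ≡ S
        start₀ = trans (cong (_* D) (val-snoc-false ρ)) (identity (val ρ) D)
          where
          identity : ∀ v D → (2 * v) * D ≡ v * (2 * D)
          identity = solve-∀
        start₁ : val (ρ ∷ʳ true) * D ≡ S + D
        start₁ = trans (cong (_* D) (val-snoc-true ρ)) (identity (val ρ) D)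
          where
          identity : ∀ v D → suc (2 * v) * D ≡ v * (2 * D) + D
          identity = solve-∀
        total : tally (val (ρ ∷ʳ false) * D) D · (2^- N) ℚ.+ tally (val (ρ ∷ʳ true) * D) D · (2^- N)
                ≡ tally S (2 ^ suc d) · (2^- N)
        total = begin
          tally (val (ρ ∷ʳ false) * D) D · (2^- N) ℚ.+ tally (val (ρ ∷ʳ true) * D) D · (2^- N)
            ≡⟨ cong₂ (λ s s′ → tally s D · (2^- N) ℚ.+ tally s′ D · (2^- N)) start₀ start₁ ⟩
          tally S D · (2^- N) ℚ.+ tally (S + D) D · (2^- N)
            ≡⟨ ·-distribʳ-+ (tally S D) (tally (S + D) D) (2^- N) ⟨
          (tally S D + tally (S + D) D) · (2^- N)
            ≡⟨ cong (_· (2^- N)) (tally-+ S D D) ⟨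
          tally S (D + D) · (2^- N)
            ≡⟨ cong (λ x → tally S (D + x) · (2^- N)) (+-identityʳ D) ⟨
          tally S (2 ^ suc d) · (2^- N) ∎
          where open ≡-Reasoning

      hit< : ∀ j → Hit j → j < 2 ^ N
      hit< j (σ , _ , _ , s≤s hi) = *-cancelʳ-≤ (1 + j) (2 ^ N) (2 ^ length σ) {{m^n≢0 2 (length σ)}}
        (≤-trans hi (≤-trans (*-monoˡ-≤ (2 ^ N) (val< σ)) (≤-reflexive (*-comm (2 ^ length σ) (2 ^ N)))))

      count≤weight : ∀ {k a} → Count Hit k a → ∃[ K ] a · (2^- N) ℚ.≤ weight c K
      count≤weight {a = a} x with tally≤mass N [] refl
      ... | K , h = K , subst (a · (2^- N) ℚ.≤_) (mass-[] c K)
        (ℚ.≤-trans (·-monoˡ-≤ (2^-nonneg N) (count≤tally (count-cap hit< x))) h)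

  -- By integrality a violation exceeds the bound by at least u = 2^-(N+n), and a cover of weight at
  -- most 2^-n + u/2 refutes it.
  measure-count : ∀ {𝒰 : Pred Cantor 0ℓ} {n} → Measure≤ 𝒰 (2^- n) →
                  (V : Pred Str 0ℓ) → (∀ X σ → σ ≺ X → V σ → 𝒰 X) → ∀ N {k a} →
                  Count (λ j → ∃[ σ ] V σ × Within (val σ) (2 ^ length σ) (2 ^ N) j) k a →
                  a * 2 ^ n ≤ 2 ^ N
  measure-count {𝒰} {n} small V V⊆𝒰 N {k} {a} x = ≮⇒≥ λ lt →
    let c , covers , bound = small ε (2^-pos (suc (N + n)))
        K , h = count≤weight c V (λ X σ σ≺X σ∈V → covers X (V⊆𝒰 X σ σ≺X σ∈V)) N x
    in ℚ.<-irrefl refl (ℚ.<-≤-trans (ℚ.+-monoˡ-< (2^- n) ε<u) (begin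
      u ℚ.+ (2^- n)               ≡⟨ cong (u ℚ.+_) (2^·2^- N n) ⟨
      suc (2 ^ N) · u             ≤⟨ ·-monoˡ-≤ (2^-nonneg (N + n)) lt ⟩
      (a * 2 ^ n) · u             ≡⟨ ·-assoc a (2 ^ n) u ⟩
      a · ((2 ^ n) · u)           ≡⟨ cong (λ m → a · ((2 ^ n) · (2^- m))) (+-comm N n) ⟩
      a · ((2 ^ n) · (2^- (n + N))) ≡⟨ cong (a ·_) (2^·2^- n N) ⟩
      a · (2^- N)                 ≤⟨ h ⟩
      weight c K                  ≤⟨ bound K ⟩
      (2^- n) ℚ.+ ε               ≡⟨ ℚ.+-comm (2^- n) ε ⟩
      ε ℚ.+ (2^- n)               ∎))
    where
    open ℚ.≤-Reasoning
    u ε : ℚ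
    u = 2^- (N + n)
    ε = 2^- suc (N + n)
    ε<u : ε ℚ.< u
    ε<u = subst₂ ℚ._<_ (ℚ.+-identityʳ ε) (2^-half (N + n)) (ℚ.+-monoʳ-< ε (2^-pos (suc (N + n))))

-- The real α

count-map : ∀ {I J k c} → (∀ j → I j → J j) → Count I k c → Count J k c
count-map h none      = none
count-map h (skip x)  = skip (count-map h x)
count-map h (hit x i) = hit (count-map h x) (h _ i)

total-map : ∀ {I J q k e f s} → (∀ e j → I e j → J e j) → Total I q k e f s → Total J q k e f s
total-map h none            = none
total-map h (add t x lo hi) = add (total-map h t) (count-map (h _) x) lo hi

count-zero : ∀ {I} k → Count I k 0
count-zero zero    = none
count-zero (suc k) = skip (count-zero k)

count-extend : ∀ {I k c} d → Count I k c → (∀ j → k ≤ j → j < d + k → I j) → Count I (d + k) (d + c)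
count-extend zero    x h = x
count-extend {k = k} (suc d) x h =
  hit (count-extend d x (λ j k≤j j<d+k → h j k≤j (m<n⇒m<1+n j<d+k))) (h (d + k) (m≤n+m k d) ≤-refl)

total-mono : ∀ {I q k k′ e f s} → k ≤ k′ → Total I q k e f s → Total I q k′ e f s
total-mono h none            = none
total-mono h (add t x lo hi) = add (total-mono h t) (count-mono h x) lo hi

total-f : ∀ {I q k e f s} → Total I q k e f s → f ≡ 2 ^ e
total-f none          = refl
total-f (add t _ _ _) = cong (2 *_) (total-f t)

-- Appending zero summands makes room for an index beyond the current number of summands.
total-pad : ∀ {I q k e f s} d → Total I q k e f s → ∃[ f′ ] Total I q k (d + e) f′ s
total-pad zero    t = _ , t
total-pad {k = k} (suc d) t =
  _ , add (proj₂ (total-pad d t)) (count-zero k) (s≤s z≤n) (s≤s z≤n)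

-- As f = 2^e, this says s/q ≤ 1 - 2^-e, the geometric sum of the caps. The summand `q` on the left
-- is what gives h < 1 at every finite stage in `total<`.
total-bound : ∀ {I q k e f s} → Total I q k e f s → s * f + q ≤ f * q
total-bound {q = q} none = ≤-reflexive (sym (+-identityʳ q))
total-bound {q = q} (add {f = f} {s} {a = a} t _ _ (s≤s hi)) = begin
  (a + s) * (2 * f) + q               ≡⟨ identity a s f q ⟩
  a * (2 * f) + (2 * (s * f) + q)     ≤⟨ +-monoˡ-≤ _ hi ⟩
  q + (2 * (s * f) + q)               ≡⟨ identity′ q (s * f) ⟩
  2 * (s * f + q)                     ≤⟨ *-monoʳ-≤ 2 (total-bound t) ⟩
  2 * (f * q)                         ≡⟨ *-assoc 2 f q ⟨
  2 * f * q                           ∎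
  where
  open ≤-Reasoning
  identity : ∀ a s f q → (a + s) * (2 * f) + q ≡ a * (2 * f) + (2 * (s * f) + q)
  identity = solve-∀
  identity′ : ∀ q x → q + (2 * x + q) ≡ 2 * (x + q)
  identity′ = solve-∀

total< : ∀ {I q k e f s} .{{_ : NonZero q}} → Total I q k e f s → s < q
total< {q = q} {f = f} {s} t = ≰⇒> λ q≤s → <⇒≱ (m<m+n (f * q) (>-nonZero⁻¹ q))
  (≤-trans (+-monoˡ-≤ q (≤-trans (≤-reflexive (*-comm f q)) (*-monoˡ-≤ f q≤s))) (total-bound t))

-- Summand e grows from a to 2d + a and the others stay. The new summand respects its cap because
-- `small` bounds all c + d counted cells: where U_e has measure at most 2^-(e+2), twice its measure
-- never exceeds 2^-(e+1).
total-gain : ∀ {I : ℕ → ℕ → Set} {q k E f s} e d → e < E → Total I q k E f s →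
             (∀ {k c} → Count (I e) k c → c * 2 ^ (2 + e) ≤ q) →
             (∀ j → k ≤ j → j < d + k → I e j) →
             ∃[ s′ ] Total I q (d + k) E f s′ × s + 2 * d ≤ s′
total-gain {q = q} {k} e d (s≤s e≤E) (add {E} {f} {s} {c} {a} t x lo hi) small cells with e ≟ E
... | yes refl = _ , add (total-mono (m≤n+m k d) t) x′ lo′ hi′ , ≤-reflexive (identity a s d)
  where
  x′ = count-extend d x cells
  identity : ∀ a s d → a + s + 2 * d ≡ 2 * d + a + s
  identity = solve-∀
  lo′ : 2 * d + a < 1 + 2 * (d + c)
  lo′ = s≤s (≤-trans (+-monoʳ-≤ (2 * d) (s≤s⁻¹ lo)) (≤-reflexive (sym (*-distribˡ-+ 2 d c))))
  identity′ : ∀ c f → 2 * c * (2 * f) ≡ c * (2 * (2 * f))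
  identity′ = solve-∀
  hi′ : (2 * d + a) * (2 * f) < 1 + q
  hi′ = s≤s (≤-trans (*-monoˡ-≤ (2 * f) (s≤s⁻¹ lo′)) (≤-trans
    (≤-reflexive (trans (identity′ (d + c) f) (cong (λ f → (d + c) * (2 * (2 * f))) (total-f t)))) (small x′)))
... | no e≢E with total-gain e d (≤∧≢⇒< e≤E e≢E) t small cells
...   | s′ , t′ , le = _ , add t′ (count-mono (m≤n+m k d) x) lo hi ,
        ≤-trans (≤-reflexive (+-assoc a s (2 * d))) (+-monoʳ-≤ a le)

length-++-2^ : ∀ (ρ δ : Str) → 2 ^ length (ρ ++ δ) ≡ 2 ^ length ρ * 2 ^ length δ
length-++-2^ ρ δ = trans (cong (2 ^_) (length-++ ρ)) (^-distribˡ-+-* 2 (length ρ) (length δ))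

val-++ : ∀ ρ δ → val (ρ ++ δ) ≡ val ρ * 2 ^ length δ + val δ
val-++ []          δ = refl
val-++ (false ∷ ρ) δ = val-++ ρ δ
val-++ (true ∷ ρ)  δ = begin
  2 ^ length (ρ ++ δ) + val (ρ ++ δ)                       ≡⟨ cong₂ _+_ (length-++-2^ ρ δ) (val-++ ρ δ) ⟩
  2 ^ length ρ * 2 ^ length δ + (val ρ * 2 ^ length δ + val δ) ≡⟨ identity (2 ^ length ρ) (2 ^ length δ) (val ρ) (val δ) ⟩
  (2 ^ length ρ + val ρ) * 2 ^ length δ + val δ            ∎
  where
  open ≡-Reasoning
  identity : ∀ R D v d → R * D + (v * D + d) ≡ (R + v) * D + d
  identity = solve-∀

-- Dyadic refinement and the points below α.

module Halving (I : ℕ → ℕ → ℕ → Set)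
  (half₀ : ∀ e q j → I e q j → I e (2 * q) (2 * j))
  (half₁ : ∀ e q j → I e q j → I e (2 * q) (1 + 2 * j)) where

  count-halve : ∀ {e q k c} → Count (I e q) k c → Count (I e (2 * q)) (2 * k) (2 * c)
  count-halve none = none
  count-halve {e} {q} (skip {k} {c} x) = subst (λ k → Count (I e (2 * q)) k (2 * c)) (sym (*-suc 2 k)) (skip (skip (count-halve x)))
  count-halve {e} {q} (hit {k} {c} x i) = subst₂ (Count _) (sym (*-suc 2 k)) (sym (*-suc 2 c))
    (hit (hit (count-halve x) (half₀ e q k i)) (half₁ e q k i))

  total-halve : ∀ {q k e f s} → Total (λ e → I e q) q k e f s →
                Total (λ e → I e (2 * q)) (2 * q) (2 * k) e f (2 * s)
  total-halve none = none
  total-halve {q} (add {f = f} {s} {c} {a} t x lo hi) =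
    subst (Total _ _ _ _ _) (sym (*-distribˡ-+ 2 a s))
      (add (total-halve t) (count-halve x) (s≤s (*-monoʳ-≤ 2 (s≤s⁻¹ lo)))
        (s≤s (≤-trans (≤-reflexive (*-assoc 2 a (2 * f))) (*-monoʳ-≤ 2 (s≤s⁻¹ hi)))))

  -- k/q < h(k/q)
  Rising : ℕ → ℕ → Set
  Rising q k = ∃[ e ] ∃[ f ] ∃[ s ] Total (λ e → I e q) q k e f s × k < s

  -- For integers, k < s gives 1 + 2k < 2s: moving half a cell to the right keeps the point rising.
  -- Hence there is no greatest rising point.
  rising-halve : ∀ {q k} → Rising q k → Rising (2 * q) (1 + 2 * k)
  rising-halve {q} {k} (e , f , s , t , k<s) = e , f , 2 * s , total-mono (n≤1+n _) (total-halve t) ,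
    ≤-trans (≤-reflexive (sym (*-suc 2 k))) (*-monoʳ-≤ 2 k<s)

  rising-halve′ : ∀ {q k} → Rising q k → Rising (2 * q) (2 * k)
  rising-halve′ (e , f , s , t , k<s) = e , f , 2 * s , total-halve t , *-monoʳ-< 2 k<s

  rising-refine : ∀ {q k} d → Rising q k → Rising (2 ^ d * q) (2 ^ d * k)
  rising-refine {q} {k} zero r = subst₂ Rising (sym (+-identityʳ q)) (sym (+-identityʳ k)) r
  rising-refine {q} {k} (suc d) r =
    subst₂ Rising (sym (*-assoc 2 (2 ^ d) q)) (sym (*-assoc 2 (2 ^ d) k)) (rising-halve′ (rising-refine d r))

  -- j/p < α
  data Below (j p : ℕ) : Set where
    below : ∀ N k → Rising (2 ^ N) k → j * 2 ^ N < k * p → Below j p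

  below-mono : ∀ {j p j′ p′} .{{_ : NonZero p}} .{{_ : NonZero p′}} → j′ * p ≤ j * p′ → Below j p → Below j′ p′
  below-mono {j} {p} {j′} {p′} le (below N k r lt) = below N k r
    (*-cancelʳ-< p _ _ (begin-strict
      j′ * 2 ^ N * p   ≡⟨ identity j′ (2 ^ N) p ⟩
      j′ * p * 2 ^ N   ≤⟨ *-monoˡ-≤ (2 ^ N) le ⟩
      j * p′ * 2 ^ N   ≡⟨ identity j p′ (2 ^ N) ⟩
      j * 2 ^ N * p′   <⟨ *-monoˡ-< p′ lt ⟩
      k * p * p′       ≡⟨ identity k p p′ ⟩
      k * p′ * p       ∎))
    where
    open ≤-Reasoning
    identity : ∀ a b c → a * b * c ≡ a * c * b
    identity = solve-∀

  ¬below-1 : ¬ Below 1 1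
  ¬below-1 (below N k (_ , _ , s , t , k<s) lt) = <-asym (<-trans k<s (total< {{m^n≢0 2 N}} t))
    (subst₂ _<_ (+-identityʳ (2 ^ N)) (*-identityʳ k) lt)

  -- The rising point may coincide with the right end of the interval; the half cell gained by
  -- `rising-halve` makes the inequality strict.
  below-cell : ∀ {v} L d {k} → Rising (2 ^ (L + d)) k → (1 + v) * 2 ^ d ≤ k → Below (1 + v) (2 ^ L)
  below-cell {v} L d {k} r le = below (suc (L + d)) (1 + 2 * k) (rising-halve r) (begin-strict
    (1 + v) * (2 * 2 ^ (L + d))     ≡⟨ cong (λ x → (1 + v) * (2 * x)) (^-distribˡ-+-* 2 L d) ⟩
    (1 + v) * (2 * (2 ^ L * 2 ^ d)) ≡⟨ identity (1 + v) (2 ^ L) (2 ^ d) ⟩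
    (2 * ((1 + v) * 2 ^ d)) * 2 ^ L ≤⟨ *-monoˡ-≤ (2 ^ L) (*-monoʳ-≤ 2 le) ⟩
    2 * k * 2 ^ L                   <⟨ *-monoˡ-< (2 ^ L) {{m^n≢0 2 L}} (n<1+n (2 * k)) ⟩
    (1 + 2 * k) * 2 ^ L             ∎)
    where
    open ≤-Reasoning
    identity : ∀ v L d → v * (2 * (L * d)) ≡ (2 * (v * d)) * L
    identity = solve-∀

  -- Here [v/2^L, (v+1)/2^L] is contained in U_e at every finer resolution, and `small` is λ(U_e) ≤
  -- 2^-(e+2) in counting form.
  module _ (e v L : ℕ)
    (cells : ∀ d j → v * 2 ^ d ≤ j → j < (1 + v) * 2 ^ d → I e (2 ^ (L + d)) j)
    (small : ∀ N {k c} → Count (I e (2 ^ N)) k c → c * 2 ^ (2 + e) ≤ 2 ^ N) where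

    -- Moving to the right end of the interval adds `suc o` to k but twice as much to s, so the weak
    -- inequality `k ≤ s` becomes strict there.
    below-gain : ∀ d {k E f s} → Total (λ e → I e (2 ^ (L + d))) (2 ^ (L + d)) k E f s → k ≤ s →
                 v * 2 ^ d ≤ k → k < (1 + v) * 2 ^ d → Below (1 + v) (2 ^ L)
    below-gain d {k} {E} {f} {s} t k≤s lo hi with m≤n⇒∃[o]m+o≡n hi
    ... | o , eq with total-pad (suc e) t
    -- Padding by `suc e` ensures that a summand with index e is present, possibly as 0.
    ...   | f′ , t′ with total-gain e (suc o) (m≤m+n (suc e) E) t′ (small (L + d))
                       (λ j k≤j j< → cells d j (≤-trans lo k≤j)
                         (subst (j <_) (trans (cong suc (+-comm o k)) eq) j<))
    ...     | s′ , t″ , le = below-cell {v} L d {suc o + k} (_ , _ , s′ , t″ , gain)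
                (≤-reflexive (trans (sym eq) (cong suc (+-comm k o))))
      where
      gain : suc o + k < s′
      gain = begin-strict
        suc o + k           ≤⟨ +-monoʳ-≤ (suc o) k≤s ⟩
        suc o + s           ≡⟨ +-comm (suc o) s ⟩
        s + suc o           <⟨ +-monoʳ-< s (m<m+n (suc o) (s≤s z≤n)) ⟩
        s + 2 * suc o       ≤⟨ le ⟩
        s′                  ∎
        where open ≤-Reasoning

    -- A rising point beyond v/2^L is either at or past the right end of the interval already, or
    -- inside it, and then `below-gain` carries it to the right end. So α cannot lie inside an
    -- interval of U_e.
    below-next : v ≡ 0 ⊎ Below v (2 ^ L) → Below (1 + v) (2 ^ L)
    -- The starting point 0 has the empty total s = 0 and is not rising; this is why `below-gain`
    -- asks for a weak inequality only.
    below-next (inj₁ refl) = below-gain 0 none z≤n z≤n (s≤s z≤n)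
    below-next (inj₂ (below N k r lt)) with (1 + v) * 2 ^ N ≤? 2 ^ L * k
    ... | yes le = below-cell {v} L N (subst (λ q → Rising q _) (sym (^-distribˡ-+-* 2 L N)) (rising-refine L r)) le
    ... | no nle with subst (λ q → Rising q (2 ^ L * k)) (sym (^-distribˡ-+-* 2 L N)) (rising-refine L r)
    ...   | _ , _ , s , t , k<s = below-gain N t (<⇒≤ k<s)
              (<⇒≤ (<-≤-trans lt (≤-reflexive (*-comm k (2 ^ L))))) (≰⇒> nle)

  -- The binary expansion of α.

  module Expansion (em : ∀ ℓ → ExcludedMiddle ℓ) where

    -- The bit is 1 exactly if the midpoint of the current interval is strictly below α, so a
    -- positive dyadic α receives the expansion ending in 1s. The invariant is v/2^n < α ≤
    -- (v+1)/2^n, with v = 0 as an alternative to the first inequality because α may not yet be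
    -- assumed positive.
    bit : ℕ → ℕ → Bool
    bit n v = does (em 0ℓ {Below (1 + 2 * v) (2 ^ suc n)})

    digit : Bool → ℕ
    digit b = if b then 1 else 0

    prefix-val : ℕ → ℕ
    prefix-val zero    = 0
    prefix-val (suc n) = digit (bit n (prefix-val n)) + 2 * prefix-val n

    expansion : Cantor
    expansion n = bit n (prefix-val n)

    below-bit : ∀ n → expansion n ≡ true → Below (1 + 2 * prefix-val n) (2 ^ suc n)
    below-bit n eq with em 0ℓ {Below (1 + 2 * prefix-val n) (2 ^ suc n)}
    below-bit n _  | yes b = b
    below-bit n () | no _

    ¬below-bit : ∀ n → expansion n ≡ false → ¬ Below (1 + 2 * prefix-val n) (2 ^ suc n)
    ¬below-bit n eq with em 0ℓ {Below (1 + 2 * prefix-val n) (2 ^ suc n)}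
    ¬below-bit n () | yes _
    ¬below-bit n _  | no ¬b = ¬b

    private
      below-double : ∀ {j p} .{{_ : NonZero p}} .{{_ : NonZero (2 * p)}} → Below j p → Below (2 * j) (2 * p)
      below-double {j} {p} = below-mono (≤-reflexive (identity j p))
        where
        identity : ∀ j p → 2 * j * p ≡ j * (2 * p)
        identity = solve-∀

      below-halve : ∀ {j p} .{{_ : NonZero p}} .{{_ : NonZero (2 * p)}} → Below (2 * j) (2 * p) → Below j p
      below-halve {j} {p} = below-mono (≤-reflexive (identity j p))
        where
        identity : ∀ j p → j * (2 * p) ≡ 2 * j * p
        identity = solve-∀

    ¬below-prefix : ∀ n → ¬ Below (1 + prefix-val n) (2 ^ n)
    ¬below-prefix zero = ¬below-1
    ¬below-prefix (suc n) b with expansion n in eq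
    ... | false = ¬below-bit n eq b
    ... | true  = ¬below-prefix n (below-halve {{m^n≢0 2 n}} {{m^n≢0 2 (suc n)}}
      (subst (λ j → Below j (2 ^ suc n)) (sym (*-suc 2 (prefix-val n))) b))

    below-prefix : ∀ n → prefix-val n ≡ 0 ⊎ Below (prefix-val n) (2 ^ n)
    below-prefix zero = inj₁ refl
    below-prefix (suc n) with expansion n in eq
    ... | true  = inj₂ (below-bit n eq)
    ... | false with below-prefix n
    ...   | inj₁ v≡0 = inj₁ (cong (2 *_) v≡0)
    ...   | inj₂ b   = inj₂ (below-double {{m^n≢0 2 n}} {{m^n≢0 2 (suc n)}} b)

    prefix-val-correct : ∀ n → val (applyUpTo expansion n) ≡ prefix-val n
    prefix-val-correct zero = refl
    prefix-val-correct (suc n) =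
      trans (cong val (sym (applyUpTo-∷ʳ expansion n))) (snoc (expansion n))
      where
      snoc : ∀ b → val (applyUpTo expansion n ∷ʳ b) ≡ digit b + 2 * prefix-val n
      snoc false = trans (val-snoc-false (applyUpTo expansion n)) (cong (2 *_) (prefix-val-correct n))
      snoc true  = trans (val-snoc-true (applyUpTo expansion n))
                         (cong (λ v → suc (2 * v)) (prefix-val-correct n))

    -- The right end of the interval of (X|n)0 is the midpoint tested by `bit`. Hence for the
    -- expansion X of α, "right end strictly below α" describes the left cut of X exactly, even if α
    -- is dyadic.
    BelowStr : Str → Set
    BelowStr σ = Below (1 + val σ) (2 ^ length σ)

    belowStr-extend : ∀ ρ δ → BelowStr ρ → BelowStr (ρ ++ δ)
    belowStr-extend ρ δ = below-mono {{m^n≢0 2 (length ρ)}} {{m^n≢0 2 (length (ρ ++ δ))}} (begin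
      (1 + val (ρ ++ δ)) * 2 ^ length ρ                    ≡⟨ cong (λ v → (1 + v) * 2 ^ length ρ) (val-++ ρ δ) ⟩
      (1 + (val ρ * 2 ^ length δ + val δ)) * 2 ^ length ρ  ≤⟨ *-monoˡ-≤ (2 ^ length ρ) last< ⟩
      (1 + val ρ) * 2 ^ length δ * 2 ^ length ρ            ≡⟨ identity (1 + val ρ) (2 ^ length δ) (2 ^ length ρ) ⟩
      (1 + val ρ) * (2 ^ length ρ * 2 ^ length δ)          ≡⟨ cong ((1 + val ρ) *_) (length-++-2^ ρ δ) ⟨
      (1 + val ρ) * 2 ^ length (ρ ++ δ)                    ∎)
      where
      open ≤-Reasoning
      identity : ∀ a b c → a * b * c ≡ a * (c * b)
      identity = solve-∀
      last< : 1 + (val ρ * 2 ^ length δ + val δ) ≤ (1 + val ρ) * 2 ^ length δ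
      last< = ≤-trans (+-monoʳ-< (val ρ * 2 ^ length δ) (val< δ)) (≤-reflexive (+-comm (val ρ * 2 ^ length δ) _))

    -- The right end of such a string is at least that of (X|n)0.
    belowStr-right : ∀ n δ → expansion n ≡ false → ¬ BelowStr (applyUpTo expansion n ++ true ∷ δ)
    belowStr-right n δ eq b = ¬below-bit n eq
      (below-mono {{m^n≢0 2 (length (X ++ true ∷ δ))}} {{m^n≢0 2 (suc n)}} (begin
        (1 + 2 * v) * 2 ^ length (X ++ true ∷ δ)   ≡⟨ cong ((1 + 2 * v) *_) len ⟩
        (1 + 2 * v) * (2 ^ n * (2 * D))            ≡⟨ identity v (2 ^ n) D ⟩
        (v * (2 * D) + D) * (2 * 2 ^ n)            ≤⟨ *-monoˡ-≤ (2 ^ suc n)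
                                                       (≤-trans (+-monoʳ-≤ (v * (2 * D)) (m≤m+n D (val δ))) (n≤1+n _)) ⟩
        (1 + (v * (2 * D) + (D + val δ))) * (2 * 2 ^ n)
          ≡⟨ cong (λ w → (1 + w) * 2 ^ suc n) (trans (val-++ X (true ∷ δ))
               (cong (λ w → w * (2 * D) + (D + val δ)) (prefix-val-correct n))) ⟨
        (1 + val (X ++ true ∷ δ)) * 2 ^ suc n      ∎) b)
      where
      open ≤-Reasoning
      X = applyUpTo expansion n
      v = prefix-val n
      D = 2 ^ length δ
      len : 2 ^ length (X ++ true ∷ δ) ≡ 2 ^ n * (2 * D)
      len = trans (length-++-2^ X (true ∷ δ)) (cong (λ l → 2 ^ l * (2 * D)) (length-applyUpTo expansion n))
      identity : ∀ v N D → (1 + 2 * v) * (N * (2 * D)) ≡ (v * (2 * D) + D) * (2 * N)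
      identity = solve-∀

    belowStr-prefix : ∀ n → BelowStr (applyUpTo expansion n) → Below (1 + prefix-val n) (2 ^ n)
    belowStr-prefix n = subst₂ (λ v l → Below (1 + v) (2 ^ l)) (prefix-val-correct n) (length-applyUpTo expansion n)

    belowStr-left : ∀ n δ → expansion n ≡ true → BelowStr (applyUpTo expansion n ++ false ∷ δ)
    belowStr-left n δ eq = subst BelowStr (++-assoc X (false ∷ []) δ) (belowStr-extend (X ∷ʳ false) δ
      (subst₂ (λ v l → Below (1 + v) (2 ^ l))
        (sym (trans (val-snoc-false X) (cong (2 *_) (prefix-val-correct n))))
        (sym (trans (len-snoc X false) (cong suc (length-applyUpTo expansion n))))
        (below-bit n eq)))
      where X = applyUpTo expansion n

-- Lexicographic position of a string relative to a sequence.

data Position (σ : Str) (X : Cantor) : Set where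
  at-prefix : ∀ n → σ ≡ applyUpTo X n → Position σ X
  to-left   : ∀ n δ → σ ≡ applyUpTo X n ++ false ∷ δ → X n ≡ true → Position σ X
  to-right  : ∀ n δ → σ ≡ applyUpTo X n ++ true ∷ δ → X n ≡ false → Position σ X

position : ∀ σ X → Position σ X
position []      X = at-prefix 0 refl
position (b ∷ σ) X with position σ (X ∘ suc)
position (false ∷ σ) X | p with X 0 in eq
... | true = to-left 0 σ refl eq
... | false = shift p
  where
  shift : Position σ (X ∘ suc) → Position (false ∷ σ) X
  shift (at-prefix n p)    = at-prefix (suc n) (cong₂ _∷_ (sym eq) p)
  shift (to-left n δ p q)  = to-left (suc n) δ (cong₂ _∷_ (sym eq) p) q
  shift (to-right n δ p q) = to-right (suc n) δ (cong₂ _∷_ (sym eq) p) q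
position (true ∷ σ) X | p with X 0 in eq
... | false = to-right 0 σ refl eq
... | true = shift p
  where
  shift : Position σ (X ∘ suc) → Position (true ∷ σ) X
  shift (at-prefix n p)    = at-prefix (suc n) (cong₂ _∷_ (sym eq) p)
  shift (to-left n δ p q)  = to-left (suc n) δ (cong₂ _∷_ (sym eq) p) q
  shift (to-right n δ p q) = to-right (suc n) δ (cong₂ _∷_ (sym eq) p) q

◁-left : ∀ n δ X → X n ≡ true → (applyUpTo X n ++ false ∷ δ) ◁ X
◁-left zero    δ X eq = zero , (λ _ ()) , subst (false Bool.<_) (sym eq) Bool.f<t
◁-left (suc n) δ X eq with ◁-left n δ (X ∘ suc) eq
... | i , agree , lt = suc i , (λ { zero _ → refl ; (suc m) (s≤s m<i) → agree m m<i }) , lt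

left-◁ : ∀ σ X → σ ◁ X → ∃[ n ] ∃[ δ ] σ ≡ applyUpTo X n ++ false ∷ δ × X n ≡ true
left-◁ (b ∷ σ) X (zero , _ , lt) with X 0 in eq
left-◁ (false ∷ σ) X (zero , _ , Bool.f<t) | true = 0 , σ , refl , eq
left-◁ (b ∷ σ) X (suc i , agree , lt) with left-◁ σ (X ∘ suc) (i , (λ m m<i → agree (suc m) (s≤s m<i)) , lt)
... | n , δ , p , q = suc n , δ , cong₂ _∷_ (agree zero (s≤s z≤n)) p , q

-- Randomness and the left cut

⌜⌝-injective : ∀ σ ρ → ⌜ σ ⌝ ≡ ⌜ ρ ⌝ → σ ≡ ρ
⌜⌝-injective []          []          _  = refl
⌜⌝-injective (false ∷ σ) (false ∷ ρ) eq = cong (false ∷_) (⌜⌝-injective σ ρ (*-cancelˡ-≡ _ _ 2 (suc-injective eq)))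
⌜⌝-injective (true ∷ σ)  (true ∷ ρ)  eq =
  cong (true ∷_) (⌜⌝-injective σ ρ (*-cancelˡ-≡ _ _ 2 (suc-injective (suc-injective eq))))
⌜⌝-injective (false ∷ σ) (true ∷ ρ)  eq = contradiction (suc-injective eq) (even≢odd ⌜ σ ⌝ ⌜ ρ ⌝)
⌜⌝-injective (true ∷ σ)  (false ∷ ρ) eq = contradiction (suc-injective (sym eq)) (even≢odd ⌜ ρ ⌝ ⌜ σ ⌝)
⌜⌝-injective []          (false ∷ ρ) ()
⌜⌝-injective []          (true ∷ ρ)  ()
⌜⌝-injective (false ∷ σ) []          ()
⌜⌝-injective (true ∷ σ)  []          ()

within-half₀ : ∀ {v p q j} → Within v p q j → Within v p (2 * q) (2 * j)
within-half₀ {v} {p} {q} {j} (s≤s lo , s≤s hi) =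
    s≤s (≤-trans (≤-reflexive (swap v q)) (≤-trans (*-monoʳ-≤ 2 lo) (≤-reflexive (sym (*-assoc 2 j p)))))
  , s≤s (≤-trans (*-monoˡ-≤ p (s≤s (n≤1+n (2 * j)))) (≤-trans (≤-reflexive (identity j p))
      (≤-trans (*-monoʳ-≤ 2 hi) (≤-reflexive (sym (swap (1 + v) q))))))
  where
  swap : ∀ a b → a * (2 * b) ≡ 2 * (a * b)
  swap = solve-∀
  identity : ∀ j p → (2 + 2 * j) * p ≡ 2 * ((1 + j) * p)
  identity = solve-∀

within-half₁ : ∀ {v p q j} → Within v p q j → Within v p (2 * q) (1 + 2 * j)
within-half₁ {v} {p} {q} {j} (s≤s lo , s≤s hi) =
    s≤s (≤-trans (≤-reflexive (swap v q)) (≤-trans (*-monoʳ-≤ 2 lo)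
      (≤-trans (≤-reflexive (sym (*-assoc 2 j p))) (m≤n+m (2 * j * p) p))))
  , s≤s (≤-trans (≤-reflexive (identity j p)) (≤-trans (*-monoʳ-≤ 2 hi) (≤-reflexive (sym (swap (1 + v) q)))))
  where
  swap : ∀ a b → a * (2 * b) ≡ 2 * (a * b)
  swap = solve-∀
  identity : ∀ j p → (2 + 2 * j) * p ≡ 2 * ((1 + j) * p)
  identity = solve-∀

within-refine : ∀ {v p} d j → v * 2 ^ d ≤ j → j < (1 + v) * 2 ^ d → Within v p (p * 2 ^ d) j
within-refine {v} {p} d j lo hi =
    s≤s (≤-trans (≤-reflexive (swap v p (2 ^ d))) (*-monoˡ-≤ p lo))
  , s≤s (≤-trans (*-monoˡ-≤ p hi) (≤-reflexive (sym (swap (1 + v) p (2 ^ d)))))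
  where
  swap : ∀ v p D → v * (p * D) ≡ v * D * p
  swap = solve-∀

module Relative (em : ∀ ℓ → ExcludedMiddle ℓ) (A : Cantor) where

  Axiom : ℕ → Pred Str 0ℓ
  Axiom e σ = ∃[ τ ] τ ≺ A × Fact e ⌜ τ ⌝ ⌜ σ ⌝

  -- The limit of `Inside` along the initial segments of `A`; measure arguments use this version,
  -- the enumeration uses finite segments.
  Cell : ℕ → ℕ → ℕ → Set
  Cell e q j = ∃[ σ ] Axiom e σ × Within (val σ) (2 ^ length σ) q j

  cell-half₀ : ∀ e q j → Cell e q j → Cell e (2 * q) (2 * j)
  cell-half₀ e q j (σ , h , w) = σ , h , within-half₀ {val σ} {2 ^ length σ} {j = j} w

  cell-half₁ : ∀ e q j → Cell e q j → Cell e (2 * q) (1 + 2 * j)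
  cell-half₁ e q j (σ , h , w) = σ , h , within-half₁ {val σ} {2 ^ length σ} {j = j} w

  open Halving Cell cell-half₀ cell-half₁ public
  open Expansion em public

  inside⇒cell : ∀ {τ q} → τ ≺ A → ∀ e j → Inside Fact ⌜ τ ⌝ q e j → Cell e q j
  inside⇒cell {τ} τ≺A e j (_ , _ , _ , _ , h , (τ′ , δ , refl , eq) , (σ , refl , refl , refl) , w) =
    σ , (τ′ , ≺-prefix δ (subst (_≺ A) (⌜⌝-injective τ (τ′ ++ δ) eq) τ≺A) , h) , w

  private
    A↾_ : ℕ → ℕ
    A↾ n = ⌜ applyUpTo A n ⌝

  inside-mono : ∀ {m n q} → m ≤ n → ∀ e j → Inside Fact (A↾ m) q e j → Inside Fact (A↾ n) q e j
  inside-mono {m} m≤n e j (τ′ , σ , v , p , h , (ρ , δ , eq , eq′) , w) with m≤n⇒∃[o]m+o≡n m≤n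
  ... | o , refl = τ′ , σ , v , p , h , (ρ , δ ++ applyUpTo (A ∘ (m +_)) o , eq , cong ⌜_⌝
    (trans (applyUpTo-+ A m o) (trans (cong (_++ applyUpTo (A ∘ (m +_)) o) (⌜⌝-injective _ _ eq′))
      (++-assoc ρ δ _)))) , w

  cell⇒inside : ∀ {e q j} → Cell e q j → ∃[ n ] Inside Fact (A↾ n) q e j
  cell⇒inside (σ , (_ , (n , refl) , h) , w) = n , _ , _ , _ , _ , h ,
    (applyUpTo A n , [] , refl , cong ⌜_⌝ (sym (++-identityʳ (applyUpTo A n)))) , (σ , refl , refl , refl) , w

  count-use : ∀ {e q k c} → Count (Cell e q) k c → ∃[ n ] Count (Inside Fact (A↾ n) q e) k c
  count-use none     = 0 , none
  count-use (skip x) = let n , y = count-use x in n , skip y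
  count-use {e} (hit {k} x i) = let n , y = count-use x; m , i′ = cell⇒inside {j = k} i in
    n ⊔ m , hit (count-map (inside-mono (m≤m⊔n n m) e) y) (inside-mono (m≤n⊔m n m) e k i′)

  -- The use principle: a finite sum refers to finitely many axioms, and the longest of their oracle
  -- parts serves for all, because `Inside` grows with the segment.
  total-use : ∀ {q k e f s} → Total (λ e → Cell e q) q k e f s →
              ∃[ n ] Total (Inside Fact (A↾ n) q) q k e f s
  total-use none = 0 , none
  total-use (add {e} t x lo hi) = let n , u = total-use t; m , y = count-use x in
    n ⊔ m , add (total-map (inside-mono (m≤m⊔n n m)) u) (count-map (inside-mono (m≤n⊔m n m) e) y) lo hi

  enumerated⇒below : ∀ σ → (Enumeration ^[ A ]) σ → BelowStr σ
  enumerated⇒below σ (τ , τ≺A , h) = go (Equivalence.to (enumeration-correct em τ σ) h)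
    where
    go : Left Fact ⌜ τ ⌝ ⌜ σ ⌝ → BelowStr σ
    go (_ , _ , _ , k , e , f , s , _ , _ , (ρ , _ , _ , refl) , t , k<s , (σ′ , eq , refl , refl) , lt)
      with ⌜⌝-injective σ σ′ eq
    ... | refl = below (length ρ) k (e , f , s , total-map (inside⇒cell τ≺A) t , k<s) lt

  below⇒enumerated : ∀ σ → BelowStr σ → (Enumeration ^[ A ]) σ
  below⇒enumerated σ (below N k (e , f , s , t , k<s) lt) =
    let n , u = total-use t in
    applyUpTo A n , (n , refl) , Equivalence.from (enumeration-correct em (applyUpTo A n) σ)
      -- Any string of length N certifies the denominator 2^N.
      ( ⌜ replicate N false ⌝ , val (replicate N false) , 2 ^ N , k , e , f , s , val σ , 2 ^ length σ
      , (replicate N false , refl , refl , cong (2 ^_) (sym (length-replicate N))) , u , k<s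
      , (σ , refl , refl , refl) , lt)

  below⇒left : ∀ σ → BelowStr σ → σ ◁ expansion
  below⇒left σ b with position σ expansion
  ... | at-prefix n refl     = contradiction (belowStr-prefix n b) (¬below-prefix n)
  ... | to-left n δ refl eq  = ◁-left n δ expansion eq
  ... | to-right n δ refl eq = contradiction b (belowStr-right n δ eq)

  left⇒below : ∀ σ → σ ◁ expansion → BelowStr σ
  left⇒below σ h with left-◁ σ expansion h
  ... | n , δ , refl , eq = belowStr-left n δ eq

  enumeration≐cut : Enumeration ^[ A ] ≐ LeftCut expansion
  enumeration≐cut = (λ {σ} h → below⇒left σ (enumerated⇒below σ h))
                  , (λ {σ} h → below⇒enumerated σ (left⇒below σ h))

  -- With e the code of the formula defining the test, level 2 + e is generated by the axioms that
  -- enter h under the index e. If it contains X through a cylinder X|n, then `below-next` puts the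
  -- right end of that interval strictly below α, against `¬below-prefix`.
  random : HigherMLRandom A expansion
  random 𝒰 ((U , (φ , φ-defines) , 𝒰≐) , small) X∈𝒰 with proj₁ (𝒰≐ (2 + ⌜ φ ⌝ᶠ)) (X∈𝒰 (2 + ⌜ φ ⌝ᶠ))
  ... | _ , (n , refl) , τ , τ≺A , u =
    ¬below-prefix n (below-next e v n cells (λ N → measure-count em {n = 2 + e} (small (2 + e)) (Axiom e) axiom⊆𝒰 N)
      (below-prefix n))
    where
    e = ⌜ φ ⌝ᶠ
    v = prefix-val n
    σ = applyUpTo expansion n
    axiom⊆𝒰 : ∀ Y ρ → ρ ≺ Y → Axiom e ρ → 𝒰 (2 + e) Y
    axiom⊆𝒰 Y ρ ρ≺Y (τ , τ≺A , h) = proj₂ (𝒰≐ (2 + e)) (ρ , ρ≺Y , τ , τ≺A ,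
      Equivalence.from (φ-defines (2 + e , τ , ρ))
        (Equivalence.to (universal-correct em φ ⌜ τ ⌝ ⌜ ρ ⌝) h))
    σ∈ : Axiom e σ
    σ∈ = τ , τ≺A , Equivalence.from (universal-correct em φ ⌜ τ ⌝ ⌜ σ ⌝)
      (Equivalence.to (φ-defines (2 + e , τ , σ)) u)
    cells : ∀ d j → v * 2 ^ d ≤ j → j < (1 + v) * 2 ^ d → Cell e (2 ^ (n + d)) j
    cells d j lo hi = σ , σ∈ , subst₂ (λ w q → Within w (2 ^ length σ) q j) (sym (prefix-val-correct n))
      (trans (cong (λ l → 2 ^ l * 2 ^ d) (length-applyUpTo expansion n)) (sym (^-distribˡ-+-* 2 n d)))
      (within-refine {v} {2 ^ length σ} d j lo hi)

theorem5p6 : (∀ ℓ → ExcludedMiddle ℓ) →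
    (∀ A → ∃[ X ] HigherLeftCE A X × HigherMLRandom A X)
    × (∃[ W ] Π¹₁ code₂ W ×
    (∀ A → ∃[ X ] HigherMLRandom A X × W ^[ A ] ≐ LeftCut X))
theorem5p6 em =
    (λ A → expansion A
         , (Enumeration , Π¹₁-Enumeration , (λ {σ} → proj₂ (enumeration≐cut A) {σ})
                                          , (λ {σ} → proj₁ (enumeration≐cut A) {σ}))
         , random A)
  , (Enumeration , Π¹₁-Enumeration , λ A → expansion A , random A , enumeration≐cut A)
  where
  open Relative em
  Π¹₁-Enumeration : Π¹₁ code₂ Enumeration
  Π¹₁-Enumeration = (rules ⇒ᶠ goal) , λ x → mk⇔ id id
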